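{- There exists an absolute constant $c' > 0$ such that for every integer $k \ge 3$ there exist a set $S_k \subset \mathbb{Z}^2$ and an integer $n_k$ (which may depend on $k$) such that no $k+1$ distinct points of $S_k$ lie on a common line and $|S_k \cap [n]^2| \ge c' k n$ for all integers $n \ge n_k$.
   Context: $[n] = \{1,2,\dots,n\}$, so $[n]^2 \subset \mathbb{Z}^2$ is the $n \times n$ grid. Lines are those of the Euclidean plane $\mathbb{R}^2$. -}

module Defs where

open import Data.Fin using (Fin)
open import Data.Integer as ℤ using (ℤ; +_)
open import Data.List using (length)
open import Data.List.Membership.Propositional using (_∈_)
open import Data.List.Relation.Unary.Unique.Propositional using (Unique)
open import Data.Nat as ℕ using (ℕ)
import Data.Nat.Properties as ℕP
open import Data.Product using (∃-syntax; _×_; _,_)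
open import Data.Rational as ℚ using (ℚ; 0ℚ; 1ℚ; ½; ∣_∣)
import Data.Rational.Properties as ℚP
import Data.Rational.Solver as ℚSolver
open import Function using (_⇔_)
open import Function.Definitions using (Injective)
open import Level using (0ℓ; Level; _⊔_)
open import Relation.Binary.PropositionalEquality
  using (_≡_; refl; sym; trans; cong; subst)
open import Relation.Nullary using (¬_)
open import Relation.Unary using (Pred)

private
  variable
    a ℓ : Level

------------------------------------------------------------------------
-- Real numbers, as Cauchy sequences of rationals up to _≃_

Eventually : Pred ℕ 0ℓ → Set
Eventually P = ∃[ N ] (∀ n → N ℕ.≤ n → P n)

Cauchy : (ℕ → ℚ) → Set
Cauchy x = ∀ ε → 0ℚ ℚ.< ε →
  ∃[ N ] (∀ m n → N ℕ.≤ m → N ℕ.≤ n → ∣ x m ℚ.- x n ∣ ℚ.< ε)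

record ℝ : Set where
  constructor mkℝ
  field
    seq    : ℕ → ℚ
    cauchy : Cauchy seq

open ℝ public

infix 4 _≃_ _≤ᴿ_ _<ᴿ_

_≃_ : ℝ → ℝ → Set
x ≃ y = ∀ ε → 0ℚ ℚ.< ε → Eventually λ n → ∣ seq x n ℚ.- seq y n ∣ ℚ.< ε

_≤ᴿ_ : ℝ → ℝ → Set
x ≤ᴿ y = ∀ ε → 0ℚ ℚ.< ε → Eventually λ n → seq x n ℚ.≤ seq y n ℚ.+ ε

-- The gap δ must be uniform: termwise x n < y n alone would only give x ≤ y.
_<ᴿ_ : ℝ → ℝ → Set
x <ᴿ y = ∃[ δ ] (0ℚ ℚ.< δ × Eventually λ n → seq x n ℚ.+ δ ℚ.≤ seq y n)

fromℚ : ℚ → ℝ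
fromℚ q = mkℝ (λ _ → q) λ ε 0<ε → 0 , λ _ _ _ _ →
  subst (λ r → ∣ r ∣ ℚ.< ε) (sym (ℚP.+-inverseʳ q)) 0<ε

fromℤ : ℤ → ℝ
fromℤ i = fromℚ (i ℚ./ 1)

fromℕ : ℕ → ℝ
fromℕ n = fromℤ (+ n)

0ᴿ : ℝ
0ᴿ = fromℚ 0ℚ

private

  half-sum : ∀ ε → ½ ℚ.* ε ℚ.+ ½ ℚ.* ε ≡ ε
  half-sum ε = trans (sym (ℚP.*-distribʳ-+ ε ½ ½)) (ℚP.*-identityˡ ε)

  half-pos : ∀ ε → 0ℚ ℚ.< ε → 0ℚ ℚ.< ½ ℚ.* ε
  half-pos ε 0<ε =
    ℚP.positive⁻¹ _ {{ℚP.pos*pos⇒pos ½ ε {{ℚ.positive 0<ε}}}}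

  sum-diff : ∀ p q r s →
    (p ℚ.+ q) ℚ.- (r ℚ.+ s) ≡ (p ℚ.- r) ℚ.+ (q ℚ.- s)
  sum-diff = solve 4
    (λ p q r s → (p :+ q) :- (r :+ s) := (p :- r) :+ (q :- s)) refl
    where open ℚSolver.+-*-Solver

  prod-diff : ∀ p q r s →
    (p ℚ.* q) ℚ.- (r ℚ.* s) ≡ p ℚ.* (q ℚ.- s) ℚ.+ s ℚ.* (p ℚ.- r)
  prod-diff = solve 4
    (λ p q r s → (p :* q) :- (r :* s) := p :* (q :- s) :+ s :* (p :- r)) refl
    where open ℚSolver.+-*-Solver

  split : ∀ p q → p ≡ (p ℚ.- q) ℚ.+ q
  split = solve 2 (λ p q → p := (p :- q) :+ q) refl
    where open ℚSolver.+-*-Solver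

  +-cauchy : ∀ x y → Cauchy x → Cauchy y → Cauchy (λ n → x n ℚ.+ y n)
  +-cauchy x y cx cy ε 0<ε
    with cx (½ ℚ.* ε) (half-pos ε 0<ε) | cy (½ ℚ.* ε) (half-pos ε 0<ε)
  ... | M , fx | N , fy = M ℕ.⊔ N , λ m n p q → begin-strict
    ∣ (x m ℚ.+ y m) ℚ.- (x n ℚ.+ y n) ∣
      ≡⟨ cong ∣_∣ (sum-diff (x m) (y m) (x n) (y n)) ⟩
    ∣ (x m ℚ.- x n) ℚ.+ (y m ℚ.- y n) ∣
      ≤⟨ ℚP.∣p+q∣≤∣p∣+∣q∣ (x m ℚ.- x n) (y m ℚ.- y n) ⟩
    ∣ x m ℚ.- x n ∣ ℚ.+ ∣ y m ℚ.- y n ∣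
      <⟨ ℚP.+-mono-<
           (fx m n (ℕP.m⊔n≤o⇒m≤o M N p) (ℕP.m⊔n≤o⇒m≤o M N q))
           (fy m n (ℕP.m⊔n≤o⇒n≤o M N p) (ℕP.m⊔n≤o⇒n≤o M N q)) ⟩
    ½ ℚ.* ε ℚ.+ ½ ℚ.* ε
      ≡⟨ half-sum ε ⟩
    ε ∎
    where open ℚP.≤-Reasoning

  bounded : ∀ x → Cauchy x →
    ∃[ B ] (ℚ.Positive B × Eventually λ n → ∣ x n ∣ ℚ.≤ B)
  bounded x cx with cx 1ℚ (ℚP.positive⁻¹ 1ℚ)
  ... | N , f =
    1ℚ ℚ.+ ∣ x N ∣ ,
    ℚP.pos+nonNeg⇒pos 1ℚ ∣ x N ∣ {{ℚP.∣-∣-nonNeg (x N)}} ,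
    N , λ n N≤n → begin
      ∣ x n ∣                           ≡⟨ cong ∣_∣ (split (x n) (x N)) ⟩
      ∣ (x n ℚ.- x N) ℚ.+ x N ∣         ≤⟨ ℚP.∣p+q∣≤∣p∣+∣q∣ (x n ℚ.- x N) (x N) ⟩
      ∣ x n ℚ.- x N ∣ ℚ.+ ∣ x N ∣
        ≤⟨ ℚP.+-monoˡ-≤ ∣ x N ∣ (ℚP.<⇒≤ (f n N N≤n ℕP.≤-refl)) ⟩
      1ℚ ℚ.+ ∣ x N ∣ ∎
    where open ℚP.≤-Reasoning

  *-bound : ∀ p q B δ → ℚ.Positive B →
    ∣ p ∣ ℚ.≤ B → ∣ q ∣ ℚ.< δ → ∣ p ℚ.* q ∣ ℚ.< B ℚ.* δ
  *-bound p q B δ B>0 p≤B q<δ = begin-strict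
    ∣ p ℚ.* q ∣      ≡⟨ ℚP.∣p*q∣≡∣p∣*∣q∣ p q ⟩
    ∣ p ∣ ℚ.* ∣ q ∣  ≤⟨ ℚP.*-monoʳ-≤-nonNeg ∣ q ∣ {{ℚP.∣-∣-nonNeg q}} p≤B ⟩
    B ℚ.* ∣ q ∣      <⟨ ℚP.*-monoʳ-<-pos B {{B>0}} q<δ ⟩
    B ℚ.* δ ∎
    where open ℚP.≤-Reasoning

  prod-close : ∀ p q r s B C δ → ℚ.Positive B → ℚ.Positive C →
    ∣ p ∣ ℚ.≤ B → ∣ s ∣ ℚ.≤ C → ∣ p ℚ.- r ∣ ℚ.< δ → ∣ q ℚ.- s ∣ ℚ.< δ →
    ∣ p ℚ.* q ℚ.- r ℚ.* s ∣ ℚ.< (B ℚ.+ C) ℚ.* δ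
  prod-close p q r s B C δ B>0 C>0 p≤B s≤C pr qs = begin-strict
    ∣ p ℚ.* q ℚ.- r ℚ.* s ∣
      ≡⟨ cong ∣_∣ (prod-diff p q r s) ⟩
    ∣ p ℚ.* (q ℚ.- s) ℚ.+ s ℚ.* (p ℚ.- r) ∣
      ≤⟨ ℚP.∣p+q∣≤∣p∣+∣q∣ (p ℚ.* (q ℚ.- s)) (s ℚ.* (p ℚ.- r)) ⟩
    ∣ p ℚ.* (q ℚ.- s) ∣ ℚ.+ ∣ s ℚ.* (p ℚ.- r) ∣
      <⟨ ℚP.+-mono-< (*-bound p (q ℚ.- s) B δ B>0 p≤B qs)
                     (*-bound s (p ℚ.- r) C δ C>0 s≤C pr) ⟩
    B ℚ.* δ ℚ.+ C ℚ.* δ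
      ≡⟨ sym (ℚP.*-distribʳ-+ δ B C) ⟩
    (B ℚ.+ C) ℚ.* δ ∎
    where open ℚP.≤-Reasoning

  divide : ∀ D ε → ℚ.Positive D → 0ℚ ℚ.< ε → ∃[ δ ] (0ℚ ℚ.< δ × D ℚ.* δ ≡ ε)
  divide D ε D>0 0<ε =
    ℚ.1/ D ℚ.* ε ,
    ℚP.positive⁻¹ (ℚ.1/ D ℚ.* ε)
      {{ℚP.pos*pos⇒pos (ℚ.1/ D) {{ℚP.1/pos⇒pos D {{D>0}}}} ε {{ℚ.positive 0<ε}}}} ,
    trans (sym (ℚP.*-assoc D (ℚ.1/ D) ε))
      (trans (cong (ℚ._* ε) (ℚP.*-inverseʳ D)) (ℚP.*-identityˡ ε))
    where
    instance
      D≠0 : ℚ.NonZero D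
      D≠0 = ℚP.pos⇒nonZero D {{D>0}}

  *-cauchy : ∀ x y → Cauchy x → Cauchy y → Cauchy (λ n → x n ℚ.* y n)
  *-cauchy x y cx cy ε 0<ε =
    let B , B>0 , K , bx = bounded x cx
        C , C>0 , L , by = bounded y cy
        δ , 0<δ , Dδ≡ε = divide (B ℚ.+ C) ε
          (ℚP.pos+pos⇒pos B {{B>0}} C {{C>0}}) 0<ε
        M , fx = cx δ 0<δ
        N , fy = cy δ 0<δ
    in (K ℕ.⊔ L) ℕ.⊔ (M ℕ.⊔ N) , λ m n p q →
      let p₁ = ℕP.m⊔n≤o⇒m≤o (K ℕ.⊔ L) (M ℕ.⊔ N) p
          p₂ = ℕP.m⊔n≤o⇒n≤o (K ℕ.⊔ L) (M ℕ.⊔ N) p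
          q₁ = ℕP.m⊔n≤o⇒m≤o (K ℕ.⊔ L) (M ℕ.⊔ N) q
          q₂ = ℕP.m⊔n≤o⇒n≤o (K ℕ.⊔ L) (M ℕ.⊔ N) q
      in subst (∣ x m ℚ.* y m ℚ.- x n ℚ.* y n ∣ ℚ.<_) Dδ≡ε
        (prod-close (x m) (y m) (x n) (y n) B C δ B>0 C>0
          (bx m (ℕP.m⊔n≤o⇒m≤o K L p₁))
          (by n (ℕP.m⊔n≤o⇒n≤o K L q₁))
          (fx m n (ℕP.m⊔n≤o⇒m≤o M N p₂) (ℕP.m⊔n≤o⇒m≤o M N q₂))
          (fy m n (ℕP.m⊔n≤o⇒n≤o M N p₂) (ℕP.m⊔n≤o⇒n≤o M N q₂)))

infixl 6 _+ᴿ_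
infixl 7 _*ᴿ_

_+ᴿ_ : ℝ → ℝ → ℝ
x +ᴿ y = mkℝ (λ n → seq x n ℚ.+ seq y n) (+-cauchy (seq x) (seq y) (cauchy x) (cauchy y))

_*ᴿ_ : ℝ → ℝ → ℝ
x *ᴿ y = mkℝ (λ n → seq x n ℚ.* seq y n) (*-cauchy (seq x) (seq y) (cauchy x) (cauchy y))

------------------------------------------------------------------------
-- Lines of the plane ℝ²

record Line : Set where
  field
    α β γ         : ℝ
    nondegenerate : ¬ (α ≃ 0ᴿ × β ≃ 0ᴿ)

points : Line → Pred (ℝ × ℝ) 0ℓ
points l (x , y) = α *ᴿ x +ᴿ β *ᴿ y ≃ γ
  where open Line l

------------------------------------------------------------------------
-- Subsets of ℤ²

embed : ℤ × ℤ → ℝ × ℝ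
embed (i , j) = fromℤ i , fromℤ j

grid : ℕ → Pred (ℤ × ℤ) 0ℓ
grid n (i , j) = (+ 1 ℤ.≤ i × i ℤ.≤ + n) × (+ 1 ℤ.≤ j × j ℤ.≤ + n)

No_Collinear : ℕ → Pred (ℤ × ℤ) 0ℓ → Set
No r Collinear S = (l : Line) (p : Fin r → ℤ × ℤ) → Injective _≡_ _≡_ p →
  (∀ i → S (p i)) → ¬ (∀ i → points l (embed (p i)))

-- A repetition-free list of exactly the elements of P; its existence makes
-- membership in P decidable when equality on A is.
HasCardinality : {A : Set a} → Pred A ℓ → ℕ → Set (a ⊔ ℓ)
HasCardinality {A = A} P m =
  ∃[ xs ] (Unique xs × (∀ (x : A) → x ∈ xs ⇔ P x) × length xs ≡ m)

{-# OPTIONS --safe #-}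

-- Points are chosen one at a time, the j-th in the box (X , 2X]² with X of order
-- j.  A line of primitive direction (a , b) meets the box in at most w = X / h + 1
-- lattice points, h = max(|a|, |b|).  Two potentials are kept of order at most
-- j X² and j X: the sum of w² over the pairs chosen so far, and the sum of w over
-- the lines through three of them.  For a random new point, the expected number of
-- 3-point lines through it, and the expected growth of the second potential, are
-- controlled by the second and the first potential; the expected growth of the
-- first is controlled by Σ 1/h² < ∞.  So some point of the box lies on no 3-point
-- line and keeps both potentials small.  This gives a set with no 4 points on a
-- line and at least c n points in [n]²; for general k, take the union of ⌊k/3⌋
-- disjoint such sets.
module Submission where

open import Defs
open import Data.Bool using (Bool; true; false)
open import Data.Empty using (⊥-elim)
open import Data.Integer as ℤ using (ℤ)
import Data.Integer.Properties as ℤP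
open import Data.Integer.Tactic.RingSolver using () renaming (solve-∀ to solve-∀ℤ)
open import Data.List
  using (List; []; _∷_; _∷ʳ_; _++_; map; filter; length; concatMap;
         upTo; applyUpTo; tabulate; cartesianProduct)
open import Data.List.Membership.Propositional using (_∈_; _∉_; lose; find)
open import Data.List.Membership.Propositional.Properties
open import Data.List.Properties
  using (length-++; length-map; length-upTo; length-applyUpTo; length-tabulate;
         map-++; map-upTo; upTo-∷ʳ)
open import Data.List.Relation.Binary.Permutation.Propositional using (↭-sym; ↭⇒↭ₛ)
open import Data.List.Relation.Binary.Permutation.Propositional.Properties using (All-resp-↭; ↭-length)
open import Data.List.Relation.Binary.Permutation.Setoid.Properties using (Unique-resp-↭)
open import Data.List.Relation.Unary.All as All using (All; []; _∷_)
import Data.List.Relation.Unary.All.Properties as AllP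
open import Data.List.Relation.Unary.AllPairs as AllPairs using (AllPairs; []; _∷_)
import Data.List.Relation.Unary.AllPairs.Properties as AllPairsP
open import Data.List.Relation.Unary.Any as Any using (Any; here; there)
open import Data.List.Relation.Unary.Linked using (Linked; _∷_)
open import Data.List.Relation.Unary.Unique.Propositional using (Unique)
open import Data.List.Relation.Unary.Unique.Propositional.Properties
  using (map⁺; map⁻; filter⁺; concat⁺; upTo⁺; applyUpTo⁺₁; tabulate⁺; cartesianProduct⁺)
open import Data.Nat
open import Data.Nat.Coprimality as Coprime using (Coprime; coprime-/gcd; coprime-divisor)
open import Data.Nat.Divisibility using (_∣_; _∣0; ∣⇒≤; m∣m*n)
open import Data.Nat.DivMod hiding (_div_)
open import Data.Nat.GCD
open import Data.Nat.ListAction using (sum)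
open import Data.Nat.ListAction.Properties using (sum-++)
open import Data.Nat.Properties
import Data.List.Sort ≤-decTotalOrder as Sort
open import Data.Nat.Tactic.RingSolver using (solve-∀)
open import Data.Product using (∃-syntax; Σ-syntax; _×_; _,_; proj₁; proj₂)
open import Data.Product.Properties using (≡-dec)
open import Data.Rational as ℚ using (ℚ; 0ℚ; 1ℚ; ½; toℚᵘ)
import Data.Rational.Properties as ℚP
import Data.Rational.Solver as ℚSolver
open import Data.Rational.Unnormalised as ℚᵘ using (mkℚᵘ; *≡*)
import Data.Rational.Unnormalised.Properties as ℚᵘP
open import Data.Sum using (_⊎_; inj₁; inj₂)
open import Function using (mk⇔)
open import Level using (Level; 0ℓ)
open import Relation.Binary.Definitions using (tri<; tri≈; tri>)
open import Relation.Binary.PropositionalEquality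
open import Relation.Nullary using (¬_; Dec; yes; no; does)
open import Relation.Nullary.Decidable using (_×-dec_)
open import Relation.Unary using (Pred; _∩_)

-- Why three points per line and not two: around a fixed point there are O(X) vectors of each height
-- h, and a line of height h has weight about X / h. Forbidding every line through two chosen points
-- would need the sum of w over all pairs, where Σ 1/h appears and the count loses a logarithm. When
-- only lines through three chosen points are forbidden, the third incidence turns w into w², and Σ
-- 1/h² converges.
--
-- The boxes leave out the coordinates up to X so that the j-th point has coordinates above j. Hence
-- the part of the set inside [n]² is a list that can be written down, and a new sequence avoids an
-- older infinite one by avoiding finitely many points at each step.
--
-- Expectations are plain sums over the box compared with `length xs * c`. Choice, incidence and
-- counting stay in integer arithmetic; the real numbers enter only to show that three lattice
-- points of a real line have zero determinant, and in the final inequality.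

private
  variable
    ℓ ℓ′ : Level
    A : Set ℓ
    B : Set ℓ′

-- Finite sums over lists

∑ : List A → (A → ℕ) → ℕ
∑ xs f = sum (map f xs)

𝟙 : Dec A → ℕ
𝟙 (yes _) = 1
𝟙 (no _)  = 0

𝟙<1 : (d : Dec A) → 𝟙 d < 1 → ¬ A
𝟙<1 (yes _) (s≤s ())
𝟙<1 (no ¬a) _ = ¬a

∑-mono : {f g : A → ℕ} (xs : List A) → (∀ {x} → x ∈ xs → f x ≤ g x) → ∑ xs f ≤ ∑ xs g
∑-mono []       f≤g = z≤n
∑-mono (x ∷ xs) f≤g = +-mono-≤ (f≤g (here refl)) (∑-mono xs (λ x∈ → f≤g (there x∈)))

∑-+ : (xs : List A) (f g : A → ℕ) → ∑ xs (λ x → f x + g x) ≡ ∑ xs f + ∑ xs g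
∑-+ []       f g = refl
∑-+ (x ∷ xs) f g rewrite ∑-+ xs f g = interchange (f x) (g x) (∑ xs f) (∑ xs g)
  where
  interchange : ∀ a b c d → a + b + (c + d) ≡ a + c + (b + d)
  interchange = solve-∀

∑-*ˡ : (c : ℕ) (xs : List A) (f : A → ℕ) → ∑ xs (λ x → c * f x) ≡ c * ∑ xs f
∑-*ˡ c []       f = sym (*-zeroʳ c)
∑-*ˡ c (x ∷ xs) f rewrite ∑-*ˡ c xs f = sym (*-distribˡ-+ c (f x) _)

∑-const : (xs : List A) (c : ℕ) → ∑ xs (λ _ → c) ≡ length xs * c
∑-const []       c = refl
∑-const (x ∷ xs) c = cong (c +_) (∑-const xs c)

∑-zero : (xs : List A) → ∑ xs (λ _ → 0) ≡ 0
∑-zero xs = trans (∑-const xs 0) (*-zeroʳ (length xs))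

∑-swap : (xs : List A) (ys : List B) (f : A → B → ℕ) →
  ∑ xs (λ x → ∑ ys (f x)) ≡ ∑ ys (λ y → ∑ xs (λ x → f x y))
∑-swap []       ys f = sym (∑-zero ys)
∑-swap (x ∷ xs) ys f rewrite ∑-swap xs ys f =
  sym (∑-+ ys (f x) (λ y → ∑ xs (λ x → f x y)))

∑-++ : (xs ys : List A) (f : A → ℕ) → ∑ (xs ++ ys) f ≡ ∑ xs f + ∑ ys f
∑-++ xs ys f = trans (cong sum (map-++ f xs ys)) (sum-++ (map f xs) (map f ys))

∑-map : (h : A → B) (xs : List A) (f : B → ℕ) → ∑ (map h xs) f ≡ ∑ xs (λ x → f (h x))
∑-map h []       f = refl
∑-map h (x ∷ xs) f = cong (f (h x) +_) (∑-map h xs f)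

∑-concatMap : (h : A → List B) (xs : List A) (f : B → ℕ) →
  ∑ (concatMap h xs) f ≡ ∑ xs (λ x → ∑ (h x) f)
∑-concatMap h []       f = refl
∑-concatMap h (x ∷ xs) f =
  trans (∑-++ (h x) (concatMap h xs) f) (cong (∑ (h x) f +_) (∑-concatMap h xs f))

∑-filter : {P : A → Set ℓ} (P? : ∀ x → Dec (P x)) (xs : List A) (f : A → ℕ) →
  ∑ (filter P? xs) f ≡ ∑ xs (λ x → 𝟙 (P? x) * f x)
∑-filter P? []       f = refl
∑-filter P? (x ∷ xs) f with P? x
... | yes _ = cong₂ _+_ (sym (+-identityʳ (f x))) (∑-filter P? xs f)
... | no  _ = ∑-filter P? xs f

∑-𝟙 : {P : A → Set ℓ} (P? : ∀ x → Dec (P x)) (xs : List A) →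
  ∑ xs (λ x → 𝟙 (P? x)) ≡ length (filter P? xs)
∑-𝟙 P? []       = refl
∑-𝟙 P? (x ∷ xs) with P? x
... | yes _ = cong suc (∑-𝟙 P? xs)
... | no  _ = ∑-𝟙 P? xs

∑-term : {x : A} (xs : List A) (f : A → ℕ) → x ∈ xs → f x ≤ ∑ xs f
∑-term (x ∷ xs) f (here refl) = m≤m+n (f x) _
∑-term (x ∷ xs) f (there x∈)  = ≤-trans (∑-term xs f x∈) (m≤n+m _ (f x))

-- The expectation argument without division: if every term reached `c`, the sum would reach
-- `length xs * c`.
below-average : (xs : List A) (f : A → ℕ) (c : ℕ) → ∑ xs f < length xs * c →
  ∃[ x ] (x ∈ xs × f x < c)
below-average (x ∷ xs) f c p with f x <? c
... | yes fx<c = x , here refl , fx<c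
... | no  fx≮c = let y , y∈ , fy<c = below-average xs f c
                       (+-cancelˡ-< c _ _ (≤-<-trans (+-monoˡ-≤ _ (≮⇒≥ fx≮c)) p))
                 in y , there y∈ , fy<c

-- Induction on `xs`: delete one occurrence of `ι x` from `ys`; by injectivity the images of the
-- remaining elements survive the deletion.
∑-injection : {xs : List A} (ys : List B) (ι : A → B) {f : A → ℕ} (g : B → ℕ) → Unique xs →
  (∀ {x x′} → x ∈ xs → x′ ∈ xs → ι x ≡ ι x′ → x ≡ x′) →
  (∀ {x} → x ∈ xs → ι x ∈ ys × f x ≤ g (ι x)) →
  ∑ xs f ≤ ∑ ys g
∑-injection {xs = []} ys ι g u inj into = z≤n
∑-injection {A = A} {xs = x ∷ xs} ys ι {f} g (x∉ ∷ u) inj into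
  with us , vs , refl ← ∈-∃++ (proj₁ (into (here refl))) = begin
    f x + ∑ xs f
      ≤⟨ +-mono-≤ (proj₂ (into (here refl)))
           (∑-injection (us ++ vs) ι g u (λ p q → inj (there p) (there q)) into′) ⟩
    g (ι x) + ∑ (us ++ vs) g            ≡⟨ cong (g (ι x) +_) (∑-++ us vs g) ⟩
    g (ι x) + (∑ us g + ∑ vs g)         ≡⟨ exchange (g (ι x)) (∑ us g) (∑ vs g) ⟩
    ∑ us g + (g (ι x) + ∑ vs g)         ≡⟨ ∑-++ us (ι x ∷ vs) g ⟨
    ∑ (us ++ ι x ∷ vs) g                ∎
  where
  open ≤-Reasoning
  exchange : ∀ a b c → a + (b + c) ≡ b + (a + c)
  exchange = solve-∀
  into′ : ∀ {y} → y ∈ xs → ι y ∈ us ++ vs × f y ≤ g (ι y)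
  into′ {y} y∈ with into (there y∈)
  ... | ιy∈ , le with ∈-++⁻ us ιy∈
  ... | inj₁ p         = ∈-++⁺ˡ p , le
  ... | inj₂ (there p) = ∈-++⁺ʳ us p , le
  ... | inj₂ (here e)  = ⊥-elim (All.lookup x∉ y∈ (sym (inj (there y∈) (here refl) e)))

length-injection : {xs : List A} (ys : List B) (ι : A → B) → Unique xs →
  (∀ {x x′} → x ∈ xs → x′ ∈ xs → ι x ≡ ι x′ → x ≡ x′) →
  (∀ {x} → x ∈ xs → ι x ∈ ys) → length xs ≤ length ys
length-injection {xs = xs} ys ι u inj into =
  subst₂ _≤_ (trans (∑-const xs 1) (*-identityʳ _)) (trans (∑-const ys 1) (*-identityʳ _))
    (∑-injection ys ι (λ _ → 1) u inj (λ x∈ → into x∈ , ≤-refl))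

-- The box and primitive directions

Point : Set
Point = ℕ × ℕ

interval : ℕ → List ℕ
interval X = applyUpTo (λ i → suc (X + i)) X

box : ℕ → List Point
box X = cartesianProduct (interval X) (interval X)

interval⁻ : ∀ {X x} → x ∈ interval X → X < x × x ≤ 2 * X
interval⁻ {X} x∈ with i , i<X , refl ← ∈-applyUpTo⁻ (λ i → suc (X + i)) x∈ =
  s≤s (m≤m+n X i) ,
  subst (suc (X + i) ≤_) (cong (X +_) (sym (+-identityʳ X)))
    (subst (_≤ X + X) (+-suc X i) (+-monoʳ-≤ X i<X))

box⁻ : ∀ {X x y} → (x , y) ∈ box X → (X < x × x ≤ 2 * X) × (X < y × y ≤ 2 * X)
box⁻ {X} r∈ = let x∈ , y∈ = ∈-cartesianProduct⁻ (interval X) (interval X) r∈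
              in interval⁻ x∈ , interval⁻ y∈

box-unique : ∀ X → Unique (box X)
box-unique X = cartesianProduct⁺ u u
  where
  u : Unique (interval X)
  u = applyUpTo⁺₁ _ X λ {i} {j} i<j _ eq → <⇒≢ i<j (+-cancelˡ-≡ X i j (suc-injective eq))

length-cartesianProduct : ∀ {a b} {A : Set a} {B : Set b} (xs : List A) (ys : List B) →
  length (cartesianProduct xs ys) ≡ length xs * length ys
length-cartesianProduct []       ys = refl
length-cartesianProduct (x ∷ xs) ys =
  trans (length-++ (map (x ,_) ys))
    (cong₂ _+_ (length-map (x ,_) ys) (length-cartesianProduct xs ys))

length-box : ∀ X → length (box X) ≡ X * X
length-box X = trans (length-cartesianProduct (interval X) (interval X)) (cong₂ _*_ l l)
  where l = length-applyUpTo (λ i → suc (X + i)) X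

-- Division and gcd with the junk divisor 0 read as 1.

infixl 7 _÷_

_÷_ : ℕ → ℕ → ℕ
m ÷ n = m / suc (pred n)

content : ℕ → ℕ → ℕ
content d e = suc (pred (gcd d e))

height : ℕ → ℕ → ℕ
height d e = (d ⊔ e) / content d e

-- The primitive vector `(a , b)` under `(d , e)`. The zero vector is given content 1 and
-- `a = b = 0`; since 0 and 0 are not coprime, `coprime` carries a hypothesis.
record Reduced (d e : ℕ) : Set where
  field
    a b     : ℕ
    d≡      : d ≡ content d e * a
    e≡      : e ≡ content d e * b
    height≡ : height d e ≡ a ⊔ b
    coprime : ¬ (d ≡ 0 × e ≡ 0) → Coprime a b

reduced : ∀ d e → Reduced d e
reduced d e with gcd d e in eq | coprime-/gcd d e
... | zero | _ = record
  { a = d ; b = e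
  ; d≡ = sym (trans (cong (λ k → suc (pred k) * d) eq) (+-identityʳ d))
  ; e≡ = sym (trans (cong (λ k → suc (pred k) * e) eq) (+-identityʳ e))
  ; height≡ = trans (cong (λ k → (d ⊔ e) / suc (pred k)) eq) (n/1≡n (d ⊔ e))
  ; coprime = λ n → ⊥-elim (n (gcd[m,n]≡0⇒m≡0 eq , gcd[m,n]≡0⇒n≡0 d eq)) }
... | suc k | c = record
  { a = d / suc k ; b = e / suc k ; d≡ = dk ; e≡ = ek
  ; height≡ = trans (cong (λ k → (d ⊔ e) / suc (pred k)) eq) hk
  ; coprime = λ _ → c }
  where
  dk : d ≡ content d e * (d / suc k)
  dk rewrite eq = sym (m*[n/m]≡n (subst (_∣ d) eq (gcd[m,n]∣m d e)))
  ek : e ≡ content d e * (e / suc k)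
  ek rewrite eq = sym (m*[n/m]≡n (subst (_∣ e) eq (gcd[m,n]∣n d e)))
  hk : (d ⊔ e) / suc k ≡ d / suc k ⊔ e / suc k
  hk = begin
    (d ⊔ e) / suc k
      ≡⟨ cong (_/ suc k) (cong₂ _⊔_ (dk′ dk) (dk′ ek)) ⟩
    (suc k * (d / suc k) ⊔ suc k * (e / suc k)) / suc k
      ≡⟨ cong (_/ suc k) (*-distribˡ-⊔ (suc k) (d / suc k) (e / suc k)) ⟨
    (suc k * (d / suc k ⊔ e / suc k)) / suc k
      ≡⟨ cong (_/ suc k) (*-comm (suc k) (d / suc k ⊔ e / suc k)) ⟩
    (d / suc k ⊔ e / suc k) * suc k / suc k
      ≡⟨ m*n/n≡m (d / suc k ⊔ e / suc k) (suc k) ⟩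
    d / suc k ⊔ e / suc k ∎
    where
    open ≡-Reasoning
    dk′ : ∀ {m} → m ≡ content d e * (m / suc k) → m ≡ suc k * (m / suc k)
    dk′ {m} = subst (λ g → m ≡ suc (pred g) * (m / suc k)) eq

-- Lattice points of a line in the box

Δx Δy : Point → Point → ℕ
Δx p q = ∣ proj₁ p - proj₁ q ∣
Δy p q = ∣ proj₂ p - proj₂ q ∣

weight : ℕ → Point → Point → ℕ
weight X p q = suc (X ÷ height (Δx p q) (Δy p q))

-- ⌊2x⌋ < 2 (⌊x⌋ + 1), and the strict inequality absorbs the `suc` in `weight`. This is what lets
-- the side of the box double without spoiling the potentials.
weight-double : ∀ X p q → weight (2 * X) p q ≤ 2 * weight X p q
weight-double X p q = begin-strict
  2 * X / s                    <⟨ *-cancelʳ-< s _ _ bound ⟩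
  2 * suc (X / s)              ∎
  where
  open ≤-Reasoning
  s = suc (pred (height (Δx p q) (Δy p q)))
  bound : (2 * X / s) * s < (2 * suc (X / s)) * s
  bound = begin-strict
    (2 * X / s) * s                  ≤⟨ m/n*n≤m (2 * X) s ⟩
    2 * X                            ≡⟨ cong (2 *_) (m≡m%n+[m/n]*n X s) ⟩
    2 * (X % s + X / s * s)          <⟨ *-monoʳ-< 2 (+-monoˡ-< (X / s * s) (m%n<n X s)) ⟩
    2 * (s + X / s * s)              ≡⟨ *-assoc 2 (suc (X / s)) s ⟨
    (2 * suc (X / s)) * s            ∎

-- Vanishing of the determinant of `q - p` and `r - p`. As an integer equation it is decidable: the
-- greedy choice filters by it, and `line-linear` may argue by contradiction.
Aligned : Point → Point → Point → Set
Aligned (px , py) (qx , qy) (rx , ry) =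
  (ℤ.+ qx ℤ.- ℤ.+ px) ℤ.* (ℤ.+ ry ℤ.- ℤ.+ py) ≡ (ℤ.+ qy ℤ.- ℤ.+ py) ℤ.* (ℤ.+ rx ℤ.- ℤ.+ px)

aligned? : ∀ p q r → Dec (Aligned p q r)
aligned? (px , py) (qx , qy) (rx , ry) = _ ℤP.≟ _

∣m-n∣-homo : ∀ m n → ℤ.∣ ℤ.+ m ℤ.- ℤ.+ n ∣ ≡ ∣ m - n ∣
∣m-n∣-homo m n = trans (cong ℤ.∣_∣ (ℤP.m-n≡m⊖n m n)) (∣m⊖n∣ m n)
  where
  ∣m⊖n∣ : ∀ m n → ℤ.∣ m ℤ.⊖ n ∣ ≡ ∣ m - n ∣
  ∣m⊖n∣ zero    zero    = refl
  ∣m⊖n∣ zero    (suc n) = refl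
  ∣m⊖n∣ (suc m) zero    = refl
  ∣m⊖n∣ (suc m) (suc n) = trans (cong ℤ.∣_∣ (ℤP.[1+m]⊖[1+n]≡m⊖n m n)) (∣m⊖n∣ m n)

-- Subtracting the two equations eliminates `p`. Absolute values lose the sign of the slope, but
-- only the size of `r - r′` matters for separation.
aligned-parallel : ∀ p q r r′ → Aligned p q r → Aligned p q r′ →
  Δx p q * Δy r r′ ≡ Δy p q * Δx r r′
aligned-parallel (px , py) (qx , qy) (rx , ry) (sx , sy) c c′ = begin
  ∣ px - qx ∣ * ∣ ry - sy ∣
    ≡⟨ cong₂ _*_ (trans (∣-∣-comm px qx) (sym (∣m-n∣-homo qx px))) (sym (∣m-n∣-homo ry sy)) ⟩
  ℤ.∣ qx′ ℤ.- px′ ∣ * ℤ.∣ ry′ ℤ.- sy′ ∣      ≡⟨ ℤP.abs-* (qx′ ℤ.- px′) (ry′ ℤ.- sy′) ⟨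
  ℤ.∣ (qx′ ℤ.- px′) ℤ.* (ry′ ℤ.- sy′) ∣      ≡⟨ cong ℤ.∣_∣ parallel ⟩
  ℤ.∣ (qy′ ℤ.- py′) ℤ.* (rx′ ℤ.- sx′) ∣      ≡⟨ ℤP.abs-* (qy′ ℤ.- py′) (rx′ ℤ.- sx′) ⟩
  ℤ.∣ qy′ ℤ.- py′ ∣ * ℤ.∣ rx′ ℤ.- sx′ ∣
    ≡⟨ cong₂ _*_ (trans (∣m-n∣-homo qy py) (∣-∣-comm qy py)) (∣m-n∣-homo rx sx) ⟩
  ∣ py - qy ∣ * ∣ rx - sx ∣ ∎
  where
  open ≡-Reasoning
  px′ = ℤ.+ px ; py′ = ℤ.+ py ; qx′ = ℤ.+ qx ; qy′ = ℤ.+ qy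
  rx′ = ℤ.+ rx ; ry′ = ℤ.+ ry ; sx′ = ℤ.+ sx ; sy′ = ℤ.+ sy
  split : ∀ u v r s → u ℤ.* (r ℤ.- s) ≡ u ℤ.* (r ℤ.- v) ℤ.- u ℤ.* (s ℤ.- v)
  split = solve-∀ℤ
  parallel : (qx′ ℤ.- px′) ℤ.* (ry′ ℤ.- sy′) ≡ (qy′ ℤ.- py′) ℤ.* (rx′ ℤ.- sx′)
  parallel = begin
    (qx′ ℤ.- px′) ℤ.* (ry′ ℤ.- sy′)          ≡⟨ split (qx′ ℤ.- px′) py′ ry′ sy′ ⟩
    (qx′ ℤ.- px′) ℤ.* (ry′ ℤ.- py′) ℤ.- (qx′ ℤ.- px′) ℤ.* (sy′ ℤ.- py′)
                                             ≡⟨ cong₂ ℤ._-_ c c′ ⟩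
    (qy′ ℤ.- py′) ℤ.* (rx′ ℤ.- px′) ℤ.- (qy′ ℤ.- py′) ℤ.* (sx′ ℤ.- px′)
                                             ≡⟨ split (qy′ ℤ.- py′) px′ rx′ sx′ ⟨
    (qy′ ℤ.- py′) ℤ.* (rx′ ℤ.- sx′)          ∎

-- `a` divides `b * u` and is coprime to `b`, so it divides `u`; being larger than `u`, it forces
-- `u` to be 0.
parallel<⇒0 : ∀ a {u v b} → Coprime a b → a * v ≡ b * u → u < a → u ≡ 0 × v ≡ 0
parallel<⇒0 a@(suc _) {zero} {v} {b} cop eq u<a =
  refl , *-cancelˡ-≡ v 0 a (trans eq (trans (*-zeroʳ b) (sym (*-zeroʳ a))))
parallel<⇒0 a {suc u} {v} cop eq u<a = ⊥-elim (<⇒≱ u<a (∣⇒≤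
  (coprime-divisor cop (subst (a ∣_) eq (m∣m*n v)))))

-- 0 and 0 are not coprime, as 2 divides both. So the larger entry is positive and the default
-- divisor 1 does not interfere.
coprime-max : ∀ {m n} → Coprime m n → n ≤ m → suc (pred m) ≡ m
coprime-max {zero}  c z≤n with () ← c {2} (2 ∣0 , 2 ∣0)
coprime-max {suc m} _ _   = refl

/-≡⇒∣-∣< : ∀ i j s .{{_ : NonZero s}} → i / s ≡ j / s → ∣ i - j ∣ < s
/-≡⇒∣-∣< i j s eq = begin-strict
  ∣ i - j ∣
    ≡⟨ cong₂ ∣_-_∣ (trans (m≡m%n+[m/n]*n i s) (+-comm (i % s) _))
                   (trans (m≡m%n+[m/n]*n j s) (+-comm (j % s) _)) ⟩
  ∣ i / s * s + i % s - j / s * s + j % s ∣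
    ≡⟨ cong (λ k → ∣ k * s + i % s - j / s * s + j % s ∣) eq ⟩
  ∣ j / s * s + i % s - j / s * s + j % s ∣
    ≡⟨ ∣m+n-m+o∣≡∣n-o∣ (j / s * s) (i % s) (j % s) ⟩
  ∣ i % s - j % s ∣            ≤⟨ ∣m-n∣≤m⊔n (i % s) (j % s) ⟩
  i % s ⊔ j % s                <⟨ ⊔-pres-<m (m%n<n i s) (m%n<n j s) ⟩
  s                            ∎
  where open ≤-Reasoning

same-block : ∀ {X x x′} s .{{_ : NonZero s}} → X < x → X < x′ →
  (x ∸ X) / s ≡ (x′ ∸ X) / s → ∣ x - x′ ∣ < s
same-block {X} {x} {x′} s X<x X<x′ eq =
  subst (_< s)
    (trans (sym (∣m+n-m+o∣≡∣n-o∣ X (x ∸ X) (x′ ∸ X)))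
           (cong₂ ∣_-_∣ (m+[n∸m]≡n (<⇒≤ X<x)) (m+[n∸m]≡n (<⇒≤ X<x′))))
    (/-≡⇒∣-∣< (x ∸ X) (x′ ∸ X) s eq)

block-bound : ∀ {X x} s .{{_ : NonZero s}} → x ≤ 2 * X → (x ∸ X) / s ∈ upTo (suc (X / s))
block-bound {X} {x} s x≤2X = ∈-upTo⁺ (s≤s (/-monoˡ-≤ s
  (≤-trans (∸-monoˡ-≤ X x≤2X) (≤-reflexive (trans (m+n∸m≡n X (X + 0)) (+-identityʳ X))))))

-- Pigeonhole: the offsets `f x ∸ X` are at most `X`, so they fall into `X / s + 1` blocks of length
-- `s`, and two values in one block differ by less than `s`.
separated-count : ∀ {ℓ} {A : Set ℓ} {X} {xs : List A} (f : A → ℕ) s .{{_ : NonZero s}} → Unique xs →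
  (∀ {x} → x ∈ xs → X < f x × f x ≤ 2 * X) →
  (∀ {x y} → x ∈ xs → y ∈ xs → ∣ f x - f y ∣ < s → x ≡ y) →
  length xs ≤ suc (X / s)
separated-count {X = X} {xs} f s u range sep =
  subst (length xs ≤_) (length-upTo (suc (X / s)))
    (length-injection (upTo (suc (X / s))) (λ x → (f x ∸ X) / s) u
      (λ x∈ y∈ eq → sep x∈ y∈ (same-block s (proj₁ (range x∈)) (proj₁ (range y∈)) eq))
      (λ x∈ → block-bound s (proj₂ (range x∈))))

-- Two points of the line differ by a multiple of the primitive vector up to signs. Projected to the
-- coordinate in which that vector is longer, distinct points are therefore at least `a ⊔ b` apart.
points-on-line : ∀ X {p q} → p ≢ q → ∑ (box X) (λ r → 𝟙 (aligned? p q r)) ≤ weight X p q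
points-on-line X {p} {q} p≢q = subst (_≤ weight X p q) (sym ∑≡length)
  (subst (λ h → length line ≤ suc (X ÷ h)) (sym height≡) (by-slope (≤-total b a)))
  where
  line : List Point
  line = filter (aligned? p q) (box X)
  line-unique : Unique line
  line-unique = filter⁺ (aligned? p q) (box-unique X)
  ∑≡length : ∑ (box X) (λ r → 𝟙 (aligned? p q r)) ≡ length line
  ∑≡length = ∑-𝟙 (aligned? p q) (box X)

  open Reduced (reduced (Δx p q) (Δy p q))
  g : ℕ
  g = content (Δx p q) (Δy p q)
  cop : Coprime a b
  cop = coprime λ { (e₁ , e₂) → p≢q (cong₂ _,_ (∣m-n∣≡0⇒m≡n e₁) (∣m-n∣≡0⇒m≡n e₂)) }

  on-line : ∀ {r} → r ∈ line → r ∈ box X × Aligned p q r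
  on-line = ∈-filter⁻ (aligned? p q) {xs = box X}

  in-range : ∀ {r} → r ∈ line →
    (X < proj₁ r × proj₁ r ≤ 2 * X) × (X < proj₂ r × proj₂ r ≤ 2 * X)
  in-range r∈ = box⁻ (proj₁ (on-line r∈))

  parallel : ∀ {r r′} → r ∈ line → r′ ∈ line → a * Δy r r′ ≡ b * Δx r r′
  parallel {r} {r′} r∈ r′∈ = *-cancelˡ-≡ _ _ g (begin
    g * (a * Δy r r′)    ≡⟨ *-assoc g a _ ⟨
    g * a * Δy r r′      ≡⟨ cong (_* Δy r r′) d≡ ⟨
    Δx p q * Δy r r′     ≡⟨ aligned-parallel p q r r′ (proj₂ (on-line r∈)) (proj₂ (on-line r′∈)) ⟩
    Δy p q * Δx r r′     ≡⟨ cong (_* Δx r r′) e≡ ⟩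
    g * b * Δx r r′      ≡⟨ *-assoc g b _ ⟩
    g * (b * Δx r r′)    ∎)
    where open ≡-Reasoning

  point≡ : ∀ {r r′} → Δx r r′ ≡ 0 → Δy r r′ ≡ 0 → r ≡ r′
  point≡ dx dy = cong₂ _,_ (∣m-n∣≡0⇒m≡n dx) (∣m-n∣≡0⇒m≡n dy)

  by-slope : b ≤ a ⊎ a ≤ b → length line ≤ suc (X ÷ (a ⊔ b))
  by-slope (inj₁ b≤a) = subst (λ h → length line ≤ suc (X ÷ h)) (sym (m≥n⇒m⊔n≡m b≤a))
    (separated-count proj₁ (suc (pred a)) line-unique (λ r∈ → proj₁ (in-range r∈))
      λ {r} {r′} r∈ r′∈ lt →
        let dx , dy = parallel<⇒0 a cop (parallel r∈ r′∈)
                        (subst (Δx r r′ <_) (coprime-max cop b≤a) lt)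
        in point≡ dx dy)
  by-slope (inj₂ a≤b) = subst (λ h → length line ≤ suc (X ÷ h)) (sym (m≤n⇒m⊔n≡n a≤b))
    (separated-count proj₂ (suc (pred b)) line-unique (λ r∈ → proj₂ (in-range r∈))
      λ {r} {r′} r∈ r′∈ lt →
        let dy , dx = parallel<⇒0 b (Coprime.sym cop) (sym (parallel r∈ r′∈))
                        (subst (Δy r r′ <_) (coprime-max (Coprime.sym cop) a≤b) lt)
        in point≡ dx dy)

-- Vectors of given height, and the sum of squared weights

distance-sign-injective : ∀ {p x y} (d : Dec (p ≤ x)) (e : Dec (p ≤ y)) →
  does d ≡ does e → ∣ p - x ∣ ≡ ∣ p - y ∣ → x ≡ y
distance-sign-injective {p} {x} {y} (yes p≤x) (yes p≤y) _ eq =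
  ∸-cancelʳ-≡ p≤x p≤y (trans (sym (m≤n⇒∣m-n∣≡n∸m p≤x)) (trans eq (m≤n⇒∣m-n∣≡n∸m p≤y)))
distance-sign-injective (no p≰x) (no p≰y) _ eq =
  ∸-cancelˡ-≡ (≰⇒≥ p≰x) (≰⇒≥ p≰y)
    (trans (sym (m≤n⇒∣n-m∣≡n∸m (≰⇒≥ p≰x))) (trans eq (m≤n⇒∣n-m∣≡n∸m (≰⇒≥ p≰y))))

⊔-⊓-order-injective : ∀ {a b a′ b′} (d : Dec (a ≤ b)) (e : Dec (a′ ≤ b′)) →
  does d ≡ does e → a ⊔ b ≡ a′ ⊔ b′ → a ⊓ b ≡ a′ ⊓ b′ → a ≡ a′ × b ≡ b′
⊔-⊓-order-injective (yes p) (yes q) _ eq⊔ eq⊓ =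
  trans (sym (m≤n⇒m⊓n≡m p)) (trans eq⊓ (m≤n⇒m⊓n≡m q)) ,
  trans (sym (m≤n⇒m⊔n≡n p)) (trans eq⊔ (m≤n⇒m⊔n≡n q))
⊔-⊓-order-injective (no p) (no q) _ eq⊔ eq⊓ =
  trans (sym (m≥n⇒m⊔n≡m (≰⇒≥ p))) (trans eq⊔ (m≥n⇒m⊔n≡m (≰⇒≥ q))) ,
  trans (sym (m≥n⇒m⊓n≡n (≰⇒≥ p))) (trans eq⊓ (m≥n⇒m⊓n≡n (≰⇒≥ q)))

-- A vector g·(a , b) with a, b coprime is coded by a ⊔ b, three sign or order
-- bits, a ⊓ b and g.
Code : Set
Code = ℕ × (Bool × Bool × Bool) × ℕ × ℕ

bools : List Bool
bools = true ∷ false ∷ []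

∈-bools : ∀ b → b ∈ bools
∈-bools true  = here refl
∈-bools false = there (here refl)

codesAt : ℕ → ℕ → List ((Bool × Bool × Bool) × ℕ × ℕ)
codesAt Y h = cartesianProduct (cartesianProduct bools (cartesianProduct bools bools))
                (cartesianProduct (upTo (suc h)) (upTo (suc (Y ÷ h))))

codes : ℕ → List Code
codes Y = concatMap (λ h → map (h ,_) (codesAt Y h)) (upTo (suc Y))

length-codesAt : ∀ Y h → length (codesAt Y h) ≡ 8 * (suc h * suc (Y ÷ h))
length-codesAt Y h = trans
  (length-cartesianProduct bits (cartesianProduct (upTo (suc h)) (upTo (suc (Y ÷ h)))))
  (cong (8 *_) (trans (length-cartesianProduct (upTo (suc h)) (upTo (suc (Y ÷ h))))
    (cong₂ _*_ (length-upTo (suc h)) (length-upTo (suc (Y ÷ h))))))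
  where bits = cartesianProduct bools (cartesianProduct bools bools)

encode : Point → Point → Code
encode p r = let open Reduced (reduced (Δx p r) (Δy p r)) in
  a ⊔ b , (does (proj₁ p ≤? proj₁ r) , does (proj₂ p ≤? proj₂ r) , does (a ≤? b)) ,
  a ⊓ b , content (Δx p r) (Δy p r)

Code-≡⁻ : ∀ {h h′ s s′ t t′ w w′ m m′ g g′} →
  _≡_ {A = Code} (h , (s , t , w) , m , g) (h′ , (s′ , t′ , w′) , m′ , g′) →
  h ≡ h′ × s ≡ s′ × t ≡ t′ × w ≡ w′ × m ≡ m′ × g ≡ g′
Code-≡⁻ refl = refl , refl , refl , refl , refl , refl

encode-injective : ∀ p r r′ → encode p r ≡ encode p r′ → r ≡ r′
encode-injective p r r′ eq =
  let module R  = Reduced (reduced (Δx p r) (Δy p r))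
      module R′ = Reduced (reduced (Δx p r′) (Δy p r′))
      h , s , t , w , m , g = Code-≡⁻ eq
      a≡ , b≡ = ⊔-⊓-order-injective (R.a ≤? R.b) (R′.a ≤? R′.b) w h m
  in cong₂ _,_
       (distance-sign-injective (proj₁ p ≤? proj₁ r) (proj₁ p ≤? proj₁ r′) s
         (trans R.d≡ (trans (cong₂ _*_ g a≡) (sym R′.d≡))))
       (distance-sign-injective (proj₂ p ≤? proj₂ r) (proj₂ p ≤? proj₂ r′) t
         (trans R.e≡ (trans (cong₂ _*_ g b≡) (sym R′.e≡))))

encode∈codes : ∀ Y .{{_ : NonZero Y}} p r → Δx p r ≤ Y → Δy p r ≤ Y → encode p r ∈ codes Y
encode∈codes Y p r d≤Y e≤Y = ∈-concatMap⁺ (λ h → map (h ,_) (codesAt Y h))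
  (lose (∈-upTo⁺ (s≤s h≤Y)) (∈-map⁺ (h ,_)
    (∈-cartesianProduct⁺
      (∈-cartesianProduct⁺ (∈-bools _) (∈-cartesianProduct⁺ (∈-bools _) (∈-bools _)))
      (∈-cartesianProduct⁺ (∈-upTo⁺ (s≤s (m⊓n≤m⊔n a b))) (∈-upTo⁺ (s≤s g≤))))))
  where
  open Reduced (reduced (Δx p r) (Δy p r))
  g = content (Δx p r) (Δy p r)
  h = a ⊔ b
  open ≤-Reasoning
  g*h≤Y : g * h ≤ Y
  g*h≤Y = begin
    g * (a ⊔ b)           ≡⟨ *-distribˡ-⊔ g a b ⟩
    g * a ⊔ g * b         ≡⟨ cong₂ _⊔_ d≡ e≡ ⟨
    Δx p r ⊔ Δy p r       ≤⟨ ⊔-lub d≤Y e≤Y ⟩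
    Y                     ∎
  h≤Y : h ≤ Y
  h≤Y = ≤-trans (m≤n*m h g) g*h≤Y
  -- The zero vector, where `r = p`: its content is the default 1 and `Y ÷ 0` is `Y`, which is at
  -- least 1.
  h≡0⇒ : h ≡ 0 → g ≤ Y ÷ h
  h≡0⇒ h≡0 = begin
    g             ≡⟨ cong₂ content (zero-side {Δx p r} a d≡ (m≤m⊔n a b))
                                   (zero-side {Δy p r} b e≡ (m≤n⊔m a b)) ⟩
    content 0 0   ≡⟨ cong (λ k → suc (pred k)) gcd[0,0]≡0 ⟩
    1             ≤⟨ >-nonZero⁻¹ Y ⟩
    Y             ≡⟨ n/1≡n Y ⟨
    Y ÷ 0         ≡⟨ cong (Y ÷_) h≡0 ⟨
    Y ÷ h         ∎
    where
    zero-side : ∀ {d} c → d ≡ g * c → c ≤ h → d ≡ 0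
    zero-side c eq c≤h = trans eq (trans (cong (g *_) (n≤0⇒n≡0 (subst (c ≤_) h≡0 c≤h))) (*-zeroʳ g))
  g≤ : g ≤ Y ÷ h
  g≤ with h in eq
  ... | zero  = subst (λ h → g ≤ Y ÷ h) eq (h≡0⇒ eq)
  ... | suc k = begin
    g                   ≡⟨ m*n/n≡m g (suc k) ⟨
    g * suc k / suc k   ≤⟨ /-monoˡ-≤ (suc k) (subst (λ h → g * h ≤ Y) eq g*h≤Y) ⟩
    Y / suc k           ∎

∑-upTo-suc : ∀ n (f : ℕ → ℕ) → ∑ (upTo (suc n)) f ≡ ∑ (upTo n) f + f n
∑-upTo-suc n f = begin
  ∑ (upTo (suc n)) f              ≡⟨ cong (λ xs → ∑ xs f) (upTo-∷ʳ n) ⟨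
  ∑ (upTo n ∷ʳ n) f     ≡⟨ ∑-++ (upTo n) (n ∷ []) f ⟩
  ∑ (upTo n) f + (f n + 0)        ≡⟨ cong (∑ (upTo n) f +_) (+-identityʳ (f n)) ⟩
  ∑ (upTo n) f + f n              ∎
  where open ≡-Reasoning

-- ∑ 1/h² ≤ 2 − 1/n over 1 ≤ h ≤ n, cleared of denominators.
∑-quotient² : ∀ X n → let q = λ i → X / suc i in
  suc n * ∑ (upTo (suc n)) (λ i → q i * q i) + X * X ≤ 2 * suc n * (X * X)
∑-quotient² X zero rewrite n/1≡n X = ≤-reflexive (eq (X * X))
  where
  eq : ∀ a → 1 * (a + 0) + a ≡ 2 * 1 * a
  eq = solve-∀
∑-quotient² X (suc n) = *-cancelˡ-≤ (suc n) (begin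
  suc n * (suc (suc n) * ∑ (upTo (suc (suc n))) q² + X * X)
    ≡⟨ cong (λ S → suc n * (suc (suc n) * S + X * X)) (∑-upTo-suc (suc n) q²) ⟩
  suc n * (suc (suc n) * (S + q * q) + X * X)
    ≡⟨ regroup n S (q * q) (X * X) ⟩
  suc (suc n) * (suc n * S) + suc n * (X * X) + suc n * suc (suc n) * (q * q)
    ≤⟨ +-monoʳ-≤ _ last-term ⟩
  suc (suc n) * (suc n * S) + suc n * (X * X) + X * X
    ≡⟨ collect n S X ⟩
  suc (suc n) * (suc n * S + X * X)
    ≤⟨ *-monoʳ-≤ (suc (suc n)) (∑-quotient² X n) ⟩
  suc (suc n) * (2 * suc n * (X * X))
    ≡⟨ swap n (X * X) ⟩
  suc n * (2 * suc (suc n) * (X * X)) ∎)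
  where
  open ≤-Reasoning
  q² : ℕ → ℕ
  q² i = X / suc i * (X / suc i)
  q = X / suc (suc n)
  S = ∑ (upTo (suc n)) q²
  last-term : suc n * suc (suc n) * (q * q) ≤ X * X
  last-term = begin
    suc n * suc (suc n) * (q * q)         ≤⟨ *-monoˡ-≤ (q * q) (*-monoˡ-≤ (suc (suc n)) (n≤1+n (suc n))) ⟩
    suc (suc n) * suc (suc n) * (q * q)   ≡⟨ square (suc (suc n)) q ⟩
    q * suc (suc n) * (q * suc (suc n))   ≤⟨ *-mono-≤ (m/n*n≤m X (suc (suc n))) (m/n*n≤m X (suc (suc n))) ⟩
    X * X                                 ∎
    where
    square : ∀ m q → m * m * (q * q) ≡ q * m * (q * m)
    square = solve-∀
  regroup : ∀ n S Q Z → suc n * (suc (suc n) * (S + Q) + Z) ≡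
    suc (suc n) * (suc n * S) + suc n * Z + suc n * suc (suc n) * Q
  regroup = solve-∀
  collect : ∀ n S X → suc (suc n) * (suc n * S) + suc n * (X * X) + X * X ≡
    suc (suc n) * (suc n * S + X * X)
  collect = solve-∀
  swap : ∀ n Z → suc (suc n) * (2 * suc n * Z) ≡ suc n * (2 * suc (suc n) * Z)
  swap = solve-∀

∑-quotient²≤ : ∀ X n → ∑ (upTo n) (λ i → X / suc i * (X / suc i)) ≤ 2 * (X * X)
∑-quotient²≤ X zero    = z≤n
∑-quotient²≤ X (suc n) = *-cancelˡ-≤ (suc n) (begin
  suc n * ∑ (upTo (suc n)) (λ i → X / suc i * (X / suc i))   ≤⟨ m≤m+n _ (X * X) ⟩
  _                                                          ≤⟨ ∑-quotient² X n ⟩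
  2 * suc n * (X * X)                                        ≡⟨ eq n (X * X) ⟩
  suc n * (2 * (X * X))                                      ∎)
  where
  open ≤-Reasoning
  eq : ∀ n Z → 2 * suc n * Z ≡ suc n * (2 * Z)
  eq = solve-∀

-- The two sides differ by the square of q - 1.
square-suc : ∀ q → suc q * suc q ≤ 2 * (q * q) + 2
square-suc zero    = s≤s z≤n
square-suc (suc k) = subst (suc (suc k) * suc (suc k) ≤_) (eq k) (m≤m+n _ (k * k))
  where
  eq : ∀ k → suc (suc k) * suc (suc k) + k * k ≡ 2 * (suc k * suc k) + 2
  eq = solve-∀

φ : ℕ → ℕ → ℕ
φ X h = suc (X ÷ h) * suc (X ÷ h)

∑-φ : ∀ X Y → ∑ (upTo (suc Y)) (φ X) ≤ 6 * (X * X) + 2 * suc Y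
∑-φ X Y = begin
  -- The term for `h = 0` comes from the zero vector; as `X ÷ 0` is `X`, it costs as much as
  -- `h = 1`.
  φ X 0 + ∑ (applyUpTo suc Y) (φ X)
    ≡⟨ cong (φ X 0 +_) (trans (cong (λ xs → ∑ xs (φ X)) (sym (map-upTo suc Y)))
                              (∑-map suc (upTo Y) (φ X))) ⟩
  φ X 0 + ∑ (upTo Y) (λ i → φ X (suc i))
    ≤⟨ +-mono-≤ (square-suc (X / 1)) (∑-mono (upTo Y) λ {i} _ → square-suc (X / suc i)) ⟩
  2 * (X / 1 * (X / 1)) + 2 + ∑ (upTo Y) (λ i → 2 * (X / suc i * (X / suc i)) + 2)
    ≡⟨ cong₂ _+_ (cong (λ x → 2 * (x * x) + 2) (n/1≡n X)) split ⟩
  2 * (X * X) + 2 + (2 * ∑ (upTo Y) (λ i → X / suc i * (X / suc i)) + Y * 2)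
    ≤⟨ +-monoʳ-≤ (2 * (X * X) + 2) (+-monoˡ-≤ (Y * 2) (*-monoʳ-≤ 2 (∑-quotient²≤ X Y))) ⟩
  2 * (X * X) + 2 + (2 * (2 * (X * X)) + Y * 2)
    ≡⟨ eq (X * X) Y ⟩
  6 * (X * X) + 2 * suc Y ∎
  where
  open ≤-Reasoning
  split : ∑ (upTo Y) (λ i → 2 * (X / suc i * (X / suc i)) + 2) ≡
          2 * ∑ (upTo Y) (λ i → X / suc i * (X / suc i)) + Y * 2
  split = trans (∑-+ (upTo Y) _ (λ _ → 2))
    (cong₂ _+_ (∑-*ˡ 2 (upTo Y) _) (trans (∑-const (upTo Y) 2) (cong (_* 2) (length-upTo Y))))
  eq : ∀ Z Y → 2 * Z + 2 + (2 * (2 * Z) + Y * 2) ≡ 6 * Z + 2 * suc Y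
  eq = solve-∀

-- The coprime pairs of height h and their multiples of height at most Y
-- number O(h · Y / h) = O(Y).
codesAt-bound : ∀ Y .{{_ : NonZero Y}} h → h ≤ Y → suc h * suc (Y ÷ h) ≤ 4 * Y
codesAt-bound Y zero h≤Y rewrite n/1≡n Y = begin
  1 * suc Y           ≡⟨ +-identityʳ (suc Y) ⟩
  1 + Y               ≤⟨ +-monoˡ-≤ Y (>-nonZero⁻¹ Y) ⟩
  Y + Y               ≤⟨ m≤m+n (Y + Y) (2 * Y) ⟩
  Y + Y + 2 * Y       ≡⟨ eq Y ⟩
  4 * Y               ∎
  where
  open ≤-Reasoning
  eq : ∀ Y → Y + Y + 2 * Y ≡ 4 * Y
  eq = solve-∀
codesAt-bound Y (suc h) h<Y = begin
  suc (suc h) * suc q               ≡⟨ expand h q ⟩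
  q * suc h + q + suc h + 1
    ≤⟨ +-mono-≤ (+-mono-≤ (+-mono-≤ (m/n*n≤m Y (suc h)) (m/n≤m Y (suc h))) h<Y) (>-nonZero⁻¹ Y) ⟩
  Y + Y + Y + Y                     ≡⟨ eq Y ⟩
  4 * Y                             ∎
  where
  open ≤-Reasoning
  q = Y / suc h
  expand : ∀ h q → suc (suc h) * suc q ≡ q * suc h + q + suc h + 1
  expand = solve-∀
  eq : ∀ Y → Y + Y + Y + Y ≡ 4 * Y
  eq = solve-∀

∑-codes : ∀ X Y .{{_ : NonZero Y}} →
  ∑ (codes Y) (λ c → φ X (proj₁ c)) ≤ 32 * Y * (6 * (X * X) + 2 * suc Y)
∑-codes X Y = begin
  ∑ (codes Y) (λ c → φ X (proj₁ c))
    ≡⟨ ∑-concatMap (λ h → map (h ,_) (codesAt Y h)) (upTo (suc Y)) (λ c → φ X (proj₁ c)) ⟩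
  ∑ (upTo (suc Y)) (λ h → ∑ (map (h ,_) (codesAt Y h)) (λ c → φ X (proj₁ c)))
    ≤⟨ ∑-mono (upTo (suc Y)) (λ {h} h∈ → at h (≤-pred (∈-upTo⁻ h∈))) ⟩
  ∑ (upTo (suc Y)) (λ h → 32 * Y * φ X h)
    ≡⟨ ∑-*ˡ (32 * Y) (upTo (suc Y)) (φ X) ⟩
  32 * Y * ∑ (upTo (suc Y)) (φ X)
    ≤⟨ *-monoʳ-≤ (32 * Y) (∑-φ X Y) ⟩
  32 * Y * (6 * (X * X) + 2 * suc Y) ∎
  where
  open ≤-Reasoning
  at : ∀ h → h ≤ Y → ∑ (map (h ,_) (codesAt Y h)) (λ c → φ X (proj₁ c)) ≤ 32 * Y * φ X h
  at h h≤Y = begin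
    ∑ (map (h ,_) (codesAt Y h)) (λ c → φ X (proj₁ c))
      ≡⟨ ∑-map (h ,_) (codesAt Y h) (λ c → φ X (proj₁ c)) ⟩
    ∑ (codesAt Y h) (λ _ → φ X h)
      ≡⟨ ∑-const (codesAt Y h) (φ X h) ⟩
    length (codesAt Y h) * φ X h
      ≡⟨ cong (_* φ X h) (length-codesAt Y h) ⟩
    8 * (suc h * suc (Y ÷ h)) * φ X h
      ≤⟨ *-monoˡ-≤ (φ X h) (*-monoʳ-≤ 8 (codesAt-bound Y h h≤Y)) ⟩
    8 * (4 * Y) * φ X h
      ≡⟨ cong (_* φ X h) (sym (*-assoc 8 4 Y)) ⟩
    32 * Y * φ X h ∎

-- Each height carries O(X) codes of squared weight about X² / h², so the sum is O(X³). The point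
-- `p` may come from an earlier box, so coordinate differences are bounded by `2 * X`, the value
-- taken for `Y`.
∑-weight² : ∀ X .{{_ : NonZero X}} p → proj₁ p ≤ 2 * X → proj₂ p ≤ 2 * X →
  ∑ (box X) (λ r → weight X p r * weight X p r) ≤ 768 * X * (X * X)
∑-weight² X p px py = begin
  ∑ (box X) (λ r → weight X p r * weight X p r)
    ≤⟨ ∑-injection (codes (2 * X)) (encode p) (λ c → φ X (proj₁ c)) (box-unique X)
         (λ _ _ → encode-injective p _ _) into ⟩
  ∑ (codes (2 * X)) (λ c → φ X (proj₁ c))
    ≤⟨ ∑-codes X (2 * X) ⟩
  32 * (2 * X) * (6 * (X * X) + 2 * suc (2 * X))
    ≡⟨ eq₁ X (X * X) ⟩
  64 * X * (6 * (X * X) + 4 * X + 2)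
    -- `X ≥ 1` bounds the lower-order terms by multiples of `X * X`; then 64 (6 + 4 + 2) = 768.
    ≤⟨ *-monoʳ-≤ (64 * X) (+-mono-≤
         (+-monoʳ-≤ (6 * (X * X)) (*-monoʳ-≤ 4 (m≤m*n X X)))
         (*-monoʳ-≤ 2 (*-mono-≤ (>-nonZero⁻¹ X) (>-nonZero⁻¹ X)))) ⟩
  64 * X * (6 * (X * X) + 4 * (X * X) + 2 * (X * X))
    ≡⟨ eq₂ X (X * X) ⟩
  768 * X * (X * X) ∎
  where
  open ≤-Reasoning
  instance
    2X≢0 : NonZero (2 * X)
    2X≢0 = m*n≢0 2 X
  distance≤ : ∀ {m n} → m ≤ 2 * X → n ≤ 2 * X → ∣ m - n ∣ ≤ 2 * X
  distance≤ {m} {n} p q = ≤-trans (∣m-n∣≤m⊔n m n) (⊔-lub p q)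
  into : ∀ {r} → r ∈ box X →
    encode p r ∈ codes (2 * X) × weight X p r * weight X p r ≤ φ X (proj₁ (encode p r))
  into {r} r∈ = let (_ , x≤) , (_ , y≤) = box⁻ {X} r∈ in
    encode∈codes (2 * X) p r (distance≤ px x≤) (distance≤ py y≤) ,
    ≤-reflexive (cong (φ X) (Reduced.height≡ (reduced (Δx p r) (Δy p r))))
  eq₁ : ∀ X Z → 32 * (2 * X) * (6 * Z + 2 * suc (2 * X)) ≡ 64 * X * (6 * Z + 4 * X + 2)
  eq₁ = solve-∀
  eq₂ : ∀ X Z → 64 * X * (6 * Z + 4 * Z + 2 * Z) ≡ 768 * X * Z
  eq₂ = solve-∀

-- The two potentials and the choice of one point

pairs : ∀ {ℓ} {A : Set ℓ} → List A → List (A × A)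
pairs []       = []
pairs (x ∷ xs) = map (_, x) xs ++ pairs xs

∈-pairs⁻-≢ : ∀ {ℓ} {A : Set ℓ} {xs : List A} {x y} → Unique xs → (x , y) ∈ pairs xs → x ≢ y
∈-pairs⁻-≢ {xs = z ∷ xs} (z∉ ∷ u) xy∈ with ∈-++⁻ (map (_, z) xs) xy∈
... | inj₂ xy∈′ = ∈-pairs⁻-≢ u xy∈′
... | inj₁ xz∈ with _ , x∈ , refl ← ∈-map⁻ (_, z) xz∈ = λ { refl → All.lookup z∉ x∈ refl }

-- A pair is listed once for each collinear triple that it begins.
rich : List Point → List (Point × Point)
rich []      = []
rich (r ∷ B) = filter (λ (p , q) → aligned? p q r) (pairs B) ++ rich B

rich⊆pairs : ∀ B {pq} → pq ∈ rich B → pq ∈ pairs B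
rich⊆pairs (r ∷ B) pq∈ with ∈-++⁻ (filter (λ (p , q) → aligned? p q r) (pairs B)) pq∈
... | inj₁ p = ∈-++⁺ʳ (map (_, r) B) (proj₁ (∈-filter⁻ (λ (p , q) → aligned? p q r) {xs = pairs B} p))
... | inj₂ p = ∈-++⁺ʳ (map (_, r) B) (rich⊆pairs B p)

weight² : ℕ → Point × Point → ℕ
weight² X (p , q) = weight X p q * weight X p q

-- Each point brings an allowance of `X * X` for the first potential and `X` for the second, and
-- `extend` must stay within it. Only the upper edge of the box is recorded in `inside`, because
-- older points may come from smaller boxes.
record Balanced (X : ℕ) (B : List Point) : Set where
  field
    unique      : Unique B
    inside      : All (λ p → proj₁ p ≤ 2 * X × proj₂ p ≤ 2 * X) B
    pairWeight  : ∑ (pairs B) (weight² X) ≤ length B * (X * X)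
    richWeight  : ∑ (rich B) (λ (p , q) → weight X p q) ≤ length B * X

balanced-[] : ∀ X → Balanced X []
balanced-[] X = record { unique = [] ; inside = [] ; pairWeight = z≤n ; richWeight = z≤n }

-- Weights at most double, so the two sums grow at most by the factors 4 and 2, exactly as `X * X`
-- and `X` do.
balanced-double : ∀ {X B} → Balanced X B → Balanced (2 * X) B
balanced-double {X} {B} bal = record
  { unique     = unique
  ; inside     = All.map (λ (x≤ , y≤) → ≤-trans x≤ X≤ , ≤-trans y≤ X≤) inside
  ; pairWeight = begin
      ∑ (pairs B) (weight² (2 * X))
        ≤⟨ ∑-mono (pairs B) (λ { {p , q} _ → *-mono-≤ (weight-double X p q) (weight-double X p q) }) ⟩
      ∑ (pairs B) (λ (p , q) → 2 * weight X p q * (2 * weight X p q))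
        ≤⟨ ∑-mono (pairs B) (λ { {p , q} _ → ≤-reflexive (eq₁ (weight X p q)) }) ⟩
      ∑ (pairs B) (λ pq → 4 * weight² X pq)    ≡⟨ ∑-*ˡ 4 (pairs B) (weight² X) ⟩
      4 * ∑ (pairs B) (weight² X)              ≤⟨ *-monoʳ-≤ 4 pairWeight ⟩
      4 * (length B * (X * X))                 ≡⟨ eq₂ (length B) X ⟩
      length B * (2 * X * (2 * X))             ∎
  ; richWeight = begin
      ∑ (rich B) (λ (p , q) → weight (2 * X) p q)
        ≤⟨ ∑-mono (rich B) (λ { {p , q} _ → weight-double X p q }) ⟩
      ∑ (rich B) (λ (p , q) → 2 * weight X p q)   ≡⟨ ∑-*ˡ 2 (rich B) (λ (p , q) → weight X p q) ⟩
      2 * ∑ (rich B) (λ (p , q) → weight X p q)   ≤⟨ *-monoʳ-≤ 2 richWeight ⟩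
      2 * (length B * X)                          ≡⟨ eq₃ (length B) X ⟩
      length B * (2 * X)                          ∎
  }
  where
  open Balanced bal
  open ≤-Reasoning
  X≤ : 2 * X ≤ 2 * (2 * X)
  X≤ = *-monoʳ-≤ 2 (m≤n*m X 2)
  eq₁ : ∀ w → 2 * w * (2 * w) ≡ 4 * (w * w)
  eq₁ = solve-∀
  eq₂ : ∀ j X → 4 * (j * (X * X)) ≡ j * (2 * X * (2 * X))
  eq₂ = solve-∀
  eq₃ : ∀ j X → 2 * (j * X) ≡ j * (2 * X)
  eq₃ = solve-∀

_≟ₚ_ : (p q : Point) → Dec (p ≡ q)
_≟ₚ_ = ≡-dec _≟_ _≟_

∑-≟≤1 : ∀ {xs} f → Unique xs → ∑ xs (λ r → 𝟙 (r ≟ₚ f)) ≤ 1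
∑-≟≤1 {xs} f u = subst (_≤ 1) (sym (∑-𝟙 (_≟ₚ f) xs))
  (length-injection (f ∷ []) (λ r → r) (filter⁺ (_≟ₚ f) u) (λ _ _ eq → eq)
    (λ r∈ → here (proj₂ (∈-filter⁻ (_≟ₚ f) {xs = xs} r∈))))

record Extension (X : ℕ) (B F : List Point) : Set where
  field
    point     : Point
    in-box    : point ∈ box X
    fresh     : point ∉ F
    not-rich  : ∀ {p q} → (p , q) ∈ rich B → ¬ Aligned p q point
    balanced  : Balanced X (point ∷ B)

-- All demands on the new point are merged into one `cost`, scaled so that `cost r < X * X` grants
-- each of them: no 3-point line and no forbidden or old point is hit, `newRich r < X`, and
-- `newPairs r < X * X`. A single averaging then suffices.
extend : ∀ {X B} F → .{{_ : NonZero X}} → Balanced X B →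
  2000 * length B ≤ X → 4 * length F ≤ X * X → Extension X B F
extend {X} {B} F bal B-small F-small = record
  { point    = r
  ; in-box   = r∈
  ; fresh    = λ r∈F → avoids (∈-++⁺ˡ r∈F) refl
  ; not-rich = λ {p} {q} pq∈ → 𝟙<1 (aligned? p q r)
      (≤-<-trans (∑-term (rich B) (λ (p , q) → 𝟙 (aligned? p q r)) pq∈) lines<1)
  ; balanced = record
    { unique     = All.tabulate (λ f∈ → avoids (∈-++⁺ʳ F f∈)) ∷ unique
    ; inside     = (let (_ , x≤) , (_ , y≤) = box⁻ {X} r∈ in x≤ , y≤) ∷ inside
    ; pairWeight = begin
        ∑ (map (_, r) B ++ pairs B) (weight² X)
          ≡⟨ ∑-++ (map (_, r) B) (pairs B) (weight² X) ⟩
        ∑ (map (_, r) B) (weight² X) + ∑ (pairs B) (weight² X)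
          ≡⟨ cong (_+ ∑ (pairs B) (weight² X)) (∑-map (_, r) B (weight² X)) ⟩
        newPairs r + ∑ (pairs B) (weight² X)
          ≤⟨ +-mono-≤ (<⇒≤ (≤-<-trans (m≤n+m _ _) cost<)) pairWeight ⟩
        X * X + j * (X * X) ∎
    ; richWeight = begin
        ∑ (filter (λ (p , q) → aligned? p q r) (pairs B) ++ rich B) w
          ≡⟨ ∑-++ (filter (λ (p , q) → aligned? p q r) (pairs B)) (rich B) w ⟩
        ∑ (filter (λ (p , q) → aligned? p q r) (pairs B)) w + ∑ (rich B) w
          ≡⟨ cong (_+ ∑ (rich B) w) (∑-filter (λ (p , q) → aligned? p q r) (pairs B) w) ⟩
        newRich r + ∑ (rich B) w
          ≤⟨ +-mono-≤ newRich≤ richWeight ⟩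
        X + j * X ∎
    }
  }
  where
  open Balanced bal
  open ≤-Reasoning
  j = length B

  w : Point × Point → ℕ
  w (p , q) = weight X p q

  lines clashes newRich newPairs cost : Point → ℕ
  lines    r = ∑ (rich B) (λ (p , q) → 𝟙 (aligned? p q r))
  clashes  r = ∑ (F ++ B) (λ f → 𝟙 (r ≟ₚ f))
  newRich  r = ∑ (pairs B) (λ (p , q) → 𝟙 (aligned? p q r) * weight X p q)
  newPairs r = ∑ B (λ p → weight² X (p , r))
  cost     r = X * X * (lines r + clashes r) + X * newRich r + newPairs r

  ∑-lines : ∑ (box X) lines ≤ j * X
  ∑-lines = begin
    ∑ (box X) lines
      ≡⟨ ∑-swap (box X) (rich B) (λ r (p , q) → 𝟙 (aligned? p q r)) ⟩
    ∑ (rich B) (λ (p , q) → ∑ (box X) (λ r → 𝟙 (aligned? p q r)))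
      ≤⟨ ∑-mono (rich B) (λ { {p , q} pq∈ → points-on-line X (∈-pairs⁻-≢ unique (rich⊆pairs B pq∈)) }) ⟩
    ∑ (rich B) (λ (p , q) → weight X p q)
      ≤⟨ richWeight ⟩
    j * X ∎

  ∑-clashes : ∑ (box X) clashes ≤ length F + j
  ∑-clashes = begin
    ∑ (box X) clashes
      ≡⟨ ∑-swap (box X) (F ++ B) (λ r f → 𝟙 (r ≟ₚ f)) ⟩
    ∑ (F ++ B) (λ f → ∑ (box X) (λ r → 𝟙 (r ≟ₚ f)))
      ≤⟨ ∑-mono (F ++ B) (λ {f} _ → ∑-≟≤1 f (box-unique X)) ⟩
    ∑ (F ++ B) (λ _ → 1)                           ≡⟨ ∑-const (F ++ B) 1 ⟩
    length (F ++ B) * 1                            ≡⟨ *-identityʳ _ ⟩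
    length (F ++ B)                                ≡⟨ length-++ F ⟩
    length F + j                                   ∎

  ∑-newRich : ∑ (box X) newRich ≤ j * (X * X)
  ∑-newRich = begin
    ∑ (box X) newRich
      ≡⟨ ∑-swap (box X) (pairs B) (λ r (p , q) → 𝟙 (aligned? p q r) * weight X p q) ⟩
    ∑ (pairs B) (λ (p , q) → ∑ (box X) (λ r → 𝟙 (aligned? p q r) * weight X p q))
      ≤⟨ ∑-mono (pairs B) (λ { {p , q} pq∈ → begin
           ∑ (box X) (λ r → 𝟙 (aligned? p q r) * weight X p q)
             ≤⟨ ∑-mono (box X) (λ {r} _ → ≤-reflexive (*-comm (𝟙 (aligned? p q r)) (weight X p q))) ⟩
           ∑ (box X) (λ r → weight X p q * 𝟙 (aligned? p q r))
             ≡⟨ ∑-*ˡ (weight X p q) (box X) (λ r → 𝟙 (aligned? p q r)) ⟩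
           weight X p q * ∑ (box X) (λ r → 𝟙 (aligned? p q r))
             ≤⟨ *-monoʳ-≤ (weight X p q) (points-on-line X (∈-pairs⁻-≢ unique pq∈)) ⟩
           weight X p q * weight X p q ∎ }) ⟩
    ∑ (pairs B) (weight² X)
      ≤⟨ pairWeight ⟩
    j * (X * X) ∎

  ∑-newPairs : ∑ (box X) newPairs ≤ j * (768 * X * (X * X))
  ∑-newPairs = begin
    ∑ (box X) newPairs                                   ≡⟨ ∑-swap (box X) B (λ r p → weight² X (p , r)) ⟩
    ∑ B (λ p → ∑ (box X) (λ r → weight² X (p , r)))
      ≤⟨ ∑-mono B (λ {p} p∈ → let px , py = All.lookup inside p∈ in ∑-weight² X p px py) ⟩
    ∑ B (λ _ → 768 * X * (X * X))                        ≡⟨ ∑-const B _ ⟩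
    j * (768 * X * (X * X))                              ∎

  -- The left side bounds the total cost divided by `X * X`. With `j ≤ j * X`, the terms in `j` make
  -- at most (1 + 1 + 1 + 768) j X = 771 j X, which is at most half of `X * X` because
  -- `2000 * j ≤ X`; `F` takes at most a quarter.
  room : (j * X + (length F + j)) + j * X + j * (768 * X) < X * X
  room = *-cancelˡ-< 4 _ _ (begin-strict
    4 * ((j * X + (length F + j)) + j * X + j * (768 * X))
      ≤⟨ *-monoʳ-≤ 4 (+-monoˡ-≤ (j * (768 * X)) (+-monoˡ-≤ (j * X)
           (+-monoʳ-≤ (j * X) (+-monoʳ-≤ (length F) (m≤m*n j X))))) ⟩
    4 * ((j * X + (length F + j * X)) + j * X + j * (768 * X))
      ≡⟨ cong (λ c → 4 * ((j * X + (length F + j * X)) + j * X + c)) (eq₀ j X) ⟩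
    4 * ((j * X + (length F + j * X)) + j * X + 768 * (j * X))
      ≡⟨ eq₁ (j * X) (length F) ⟩
    4 * length F + 3084 * (j * X)
      ≤⟨ +-mono-≤ F-small (*-monoˡ-≤ (j * X) (m≤m+n 3084 916)) ⟩
    X * X + 4000 * (j * X)
      ≡⟨ cong (X * X +_) (eq₂ j X) ⟩
    X * X + 2 * (2000 * j * X)
      ≤⟨ +-monoʳ-≤ (X * X) (*-monoʳ-≤ 2 (*-monoˡ-≤ X B-small)) ⟩
    X * X + 2 * (X * X)
      <⟨ m<n+m _ {X * X} (*-mono-< {0} {X} {0} {X} (>-nonZero⁻¹ X) (>-nonZero⁻¹ X)) ⟩
    4 * (X * X) ∎)
    where
    eq₀ : ∀ j X → j * (768 * X) ≡ 768 * (j * X)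
    eq₀ = solve-∀
    eq₁ : ∀ a f → 4 * ((a + (f + a)) + a + 768 * a) ≡ 4 * f + 3084 * a
    eq₁ = solve-∀
    eq₂ : ∀ j X → 4000 * (j * X) ≡ 2 * (2000 * j * X)
    eq₂ = solve-∀

  average : ∑ (box X) cost < length (box X) * (X * X)
  average = begin-strict
    ∑ (box X) cost
      ≡⟨ ∑-+ (box X) (λ r → X * X * (lines r + clashes r) + X * newRich r) newPairs ⟩
    ∑ (box X) (λ r → X * X * (lines r + clashes r) + X * newRich r) + ∑ (box X) newPairs
      ≡⟨ cong (_+ ∑ (box X) newPairs)
           (∑-+ (box X) (λ r → X * X * (lines r + clashes r)) (λ r → X * newRich r)) ⟩
    ∑ (box X) (λ r → X * X * (lines r + clashes r)) + ∑ (box X) (λ r → X * newRich r)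
      + ∑ (box X) newPairs
      ≡⟨ cong (_+ ∑ (box X) newPairs) (cong₂ _+_
           (trans (∑-*ˡ (X * X) (box X) (λ r → lines r + clashes r))
                  (cong (X * X *_) (∑-+ (box X) lines clashes)))
           (∑-*ˡ X (box X) newRich)) ⟩
    X * X * (∑ (box X) lines + ∑ (box X) clashes) + X * ∑ (box X) newRich + ∑ (box X) newPairs
      ≤⟨ +-mono-≤ (+-mono-≤ (*-monoʳ-≤ (X * X) (+-mono-≤ ∑-lines ∑-clashes))
                            (*-monoʳ-≤ X ∑-newRich)) ∑-newPairs ⟩
    X * X * (j * X + (length F + j)) + X * (j * (X * X)) + j * (768 * X * (X * X))
      ≡⟨ eq j X (length F) ⟩
    X * X * ((j * X + (length F + j)) + j * X + j * (768 * X))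
      <⟨ *-monoʳ-< (X * X) {{m*n≢0 X X}} room ⟩
    X * X * (X * X)
      ≡⟨ cong (_* (X * X)) (length-box X) ⟨
    length (box X) * (X * X) ∎
    where
    eq : ∀ j X f → X * X * (j * X + (f + j)) + X * (j * (X * X)) + j * (768 * X * (X * X)) ≡
      X * X * ((j * X + (f + j)) + j * X + j * (768 * X))
    eq = solve-∀

  found = below-average (box X) cost (X * X) average
  r     = proj₁ found
  r∈    = proj₁ (proj₂ found)
  cost< = proj₂ (proj₂ found)

  hits<1 : lines r + clashes r < 1
  hits<1 = *-cancelˡ-< (X * X) _ _ (subst (X * X * (lines r + clashes r) <_) (sym (*-identityʳ (X * X)))
    (≤-<-trans (≤-trans (m≤m+n _ (X * newRich r)) (m≤m+n _ (newPairs r))) cost<))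
  lines<1 : lines r < 1
  lines<1 = ≤-<-trans (m≤m+n (lines r) (clashes r)) hits<1
  clashes<1 : clashes r < 1
  clashes<1 = ≤-<-trans (m≤n+m (clashes r) (lines r)) hits<1
  avoids : ∀ {f} → f ∈ F ++ B → r ≢ f
  avoids f∈ = 𝟙<1 (r ≟ₚ _) (≤-<-trans (∑-term (F ++ B) (λ f → 𝟙 (r ≟ₚ f)) f∈) clashes<1)
  newRich≤ : newRich r ≤ X
  newRich≤ = <⇒≤ (*-cancelˡ-< X _ _
    (≤-<-trans (≤-trans (m≤n+m (X * newRich r) _) (m≤m+n _ (newPairs r))) cost<))

-- The infinite greedy sequence

-- The step that adds a point to j others needs a box of side at least 2000 j; the
-- side changes only by doubling, under which the potentials scale exactly.
grow : (j X : ℕ) → Dec (2000 * j ≤ X) → ℕ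
grow j X (yes _) = X
grow j X (no _)  = 2 * X

roomy? : ∀ j X → Dec (2000 * j ≤ X)
roomy? j X = 2000 * j ≤? X

side : ℕ → ℕ → ℕ
side X₀ zero    = X₀
side X₀ (suc j) = grow (suc j) (side X₀ j) (roomy? (suc j) (side X₀ j))

grow-≥ : ∀ j X d → X ≤ grow j X d
grow-≥ j X (yes _) = ≤-refl
grow-≥ j X (no _)  = m≤n*m X 2

-- One doubling is enough: one copy of `X` covers `2000 * j`, the other the additional 2000.
grow-room : ∀ j X d → 2000 ≤ X → 2000 * j ≤ X → 2000 * suc j ≤ grow (suc j) X d
grow-room j X (yes p) _ _ = p
grow-room j X (no _) 2000≤X p = subst₂ _≤_ (sym (*-suc 2000 j)) (cong (X +_) (sym (+-identityʳ X)))
  (+-mono-≤ 2000≤X p)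

-- Doubling takes place only below the threshold `2000 * suc j`, so it ends below twice that. The
-- side thus stays linear in the index, which is the source of the linear density.
grow-≤ : ∀ X₀ j X d → X ≤ X₀ + 4000 * j → grow (suc j) X d ≤ X₀ + 4000 * suc j
grow-≤ X₀ j X (yes _) p = ≤-trans p (+-monoʳ-≤ X₀ (*-monoʳ-≤ 4000 (n≤1+n j)))
grow-≤ X₀ j X (no q)  _ = begin
  2 * X                    ≤⟨ *-monoʳ-≤ 2 (<⇒≤ (≰⇒> q)) ⟩
  2 * (2000 * suc j)       ≡⟨ *-assoc 2 2000 (suc j) ⟨
  4000 * suc j             ≤⟨ m≤n+m (4000 * suc j) X₀ ⟩
  X₀ + 4000 * suc j        ∎
  where open ≤-Reasoning

side-≥ : ∀ X₀ j → X₀ ≤ side X₀ j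
side-≥ X₀ zero    = ≤-refl
side-≥ X₀ (suc j) = ≤-trans (side-≥ X₀ j) (grow-≥ (suc j) (side X₀ j) (roomy? (suc j) (side _ j)))

side-room : ∀ {X₀} → 2000 ≤ X₀ → ∀ j → 2000 * j ≤ side X₀ j
side-room p zero    = z≤n
side-room p (suc j) = grow-room j (side _ j) (roomy? (suc j) (side _ j))
  (≤-trans p (side-≥ _ j)) (side-room p j)

side-≤ : ∀ X₀ j → side X₀ j ≤ X₀ + 4000 * j
side-≤ X₀ zero    = ≤-reflexive (sym (+-identityʳ X₀))
side-≤ X₀ (suc j) = grow-≤ X₀ j (side X₀ j) (roomy? (suc j) (side _ j)) (side-≤ X₀ j)

index<side : ∀ {X₀} → 2000 ≤ X₀ → ∀ j → j ≤ side X₀ j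
index<side p j = ≤-trans (m≤n*m j 2000) (side-room p j)

record Sequence (X₀ : ℕ) : Set where
  field
    point    : ℕ → Point
    in-box   : ∀ j → point j ∈ box (side X₀ j)
    distinct : ∀ {i j} → i < j → point i ≢ point j
    no-four  : ∀ {i j k l} → i < j → j < k → k < l →
      Aligned (point i) (point j) (point k) → ¬ Aligned (point i) (point j) (point l)

-- The forbidden list `F j` depends on the step, so that infinite sequences can be avoided through
-- lists that are small against the current box.
module Greedy (X₀ : ℕ) (2000≤X₀ : 2000 ≤ X₀) (F : ℕ → List Point)
  (F-small : ∀ j → 4 * length (F j) ≤ side X₀ j * side X₀ j) where

  State : ℕ → Set
  State j = Σ[ B ∈ List Point ] length B ≡ j × Balanced (side X₀ j) B

  extension : ∀ j (s : State j) → Extension (side X₀ j) (proj₁ s) (F j)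
  extension j (B , refl , bal) = extend (F j) bal (side-room 2000≤X₀ j) (F-small j)
    where
    instance
      side≢0 : NonZero (side X₀ j)
      side≢0 = >-nonZero (<-≤-trans z<s (≤-trans 2000≤X₀ (side-≥ X₀ j)))

  balanced-grow : ∀ {B} j X d → Balanced X B → Balanced (grow j X d) B
  balanced-grow j X (yes _) bal = bal
  balanced-grow j X (no _)  bal = balanced-double bal

  state : ∀ j → State j
  state zero    = [] , refl , balanced-[] X₀
  state (suc j) = let s@(B , len , _) = state j ; e = extension j s in
    Extension.point e ∷ B , cong suc len ,
    balanced-grow (suc j) (side X₀ j) (roomy? (suc j) (side _ j)) (Extension.balanced e)

  built : ℕ → List Point
  built j = proj₁ (state j)

  module Step j = Extension (extension j (state j))

  built∋ : ∀ {i j} → i < j → Step.point i ∈ built j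
  built∋ {i} {suc j} (s≤s i≤j) with m≤n⇒m<n∨m≡n i≤j
  ... | inj₁ i<j  = there (built∋ i<j)
  ... | inj₂ refl = here refl

  pairs∋ : ∀ {i j k} → i < j → j < k → (Step.point i , Step.point j) ∈ pairs (built k)
  pairs∋ {i} {j} {suc k} i<j (s≤s j≤k) with m≤n⇒m<n∨m≡n j≤k
  ... | inj₁ j<k  = ∈-++⁺ʳ (map (_, Step.point k) (built k)) (pairs∋ i<j j<k)
  ... | inj₂ refl = ∈-++⁺ˡ (∈-map⁺ (_, Step.point j) (built∋ i<j))

  -- The pair enters `rich` when the third point `k` is added and is never removed, so every later
  -- point is tested against that line.
  rich∋ : ∀ {i j k l} → i < j → j < k → k < l →
    Aligned (Step.point i) (Step.point j) (Step.point k) →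
    (Step.point i , Step.point j) ∈ rich (built l)
  rich∋ {i} {j} {k} {suc l} i<j j<k (s≤s k≤l) c with m≤n⇒m<n∨m≡n k≤l
  ... | inj₁ k<l  = ∈-++⁺ʳ _ (rich∋ i<j j<k k<l c)
  ... | inj₂ refl = ∈-++⁺ˡ (∈-filter⁺ (λ (p , q) → aligned? p q (Step.point k)) (pairs∋ i<j j<k) c)

  sequence : Sequence X₀
  sequence = record
    { point    = Step.point
    ; in-box   = Step.in-box
    ; distinct = λ {i} {j} i<j eq → All.lookup
        (AllPairs.head (Balanced.unique (Step.balanced j))) (built∋ i<j) (sym eq)
    ; no-four  = λ {l = l} i<j j<k k<l c → Step.not-rich l (rich∋ i<j j<k k<l c)
    }

-- Pairwise disjoint sequences

open Sequence

Disjoint : ∀ {X₀} → Sequence X₀ → Sequence X₀ → Set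
Disjoint s s′ = ∀ i j → point s i ≢ point s′ j

length-concatMap : ∀ {a b} {A : Set a} {B : Set b} (f : A → List B) xs n →
  (∀ x → length (f x) ≡ n) → length (concatMap f xs) ≡ length xs * n
length-concatMap f []       n len = refl
length-concatMap f (x ∷ xs) n len =
  trans (length-++ (f x)) (cong₂ _+_ (len x) (length-concatMap f xs n len))

firstPoints : ∀ {X₀} → ℕ → Sequence X₀ → List Point
firstPoints n s = map (point s) (upTo n)

length-firstPoints : ∀ {X₀} n (s : Sequence X₀) → length (firstPoints n s) ≡ n
length-firstPoints n s = trans (length-map (point s) (upTo n)) (length-upTo n)

-- The sequences are built one after another with common sides. From each of the t earlier ones the
-- first `2 * side X₀ j` points are forbidden at step j; four times their number is 8 t `side X₀ j`,
-- at most the area of the box since `X₀` dominates 8 t.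
disjointSequences : ∀ {X₀} t → 2000 ≤ X₀ → 8 * t ≤ X₀ →
  Σ[ ss ∈ List (Sequence X₀) ] length ss ≡ t × AllPairs Disjoint ss
disjointSequences zero    _ _ = [] , refl , []
disjointSequences {X₀} (suc t) p q
  with ss , refl , disjoint ← disjointSequences {X₀} t p (≤-trans (*-monoʳ-≤ 8 (n≤1+n t)) q)
  = new ∷ ss , refl , All.tabulate new-disjoint ∷ disjoint
  where
  F : ℕ → List Point
  F j = concatMap (firstPoints (2 * side X₀ j)) ss

  F-small : ∀ j → 4 * length (F j) ≤ side X₀ j * side X₀ j
  F-small j = begin
    4 * length (F j)
      ≡⟨ cong (4 *_) (length-concatMap _ ss _ (length-firstPoints _)) ⟩
    4 * (length ss * (2 * side X₀ j))
      ≡⟨ eq (length ss) (side X₀ j) ⟩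
    8 * length ss * side X₀ j
      ≤⟨ *-monoˡ-≤ (side X₀ j)
           (≤-trans (*-monoʳ-≤ 8 (n≤1+n (length ss))) (≤-trans q (side-≥ X₀ j))) ⟩
    side X₀ j * side X₀ j ∎
    where
    open ≤-Reasoning
    eq : ∀ t X → 4 * (t * (2 * X)) ≡ 8 * t * X
    eq = solve-∀

  open Greedy X₀ p F F-small

  new : Sequence X₀
  new = sequence

  -- An equality point new i ≡ point s j forces j < side X₀ j < 2 · side X₀ i, so
  -- the finite list F i suffices.
  new-disjoint : ∀ {s} → s ∈ ss → Disjoint new s
  new-disjoint {s} s∈ i j eq = Step.fresh i (∈-concatMap⁺ (firstPoints (2 * side X₀ i)) {xs = ss}
    (lose s∈ (subst (_∈ firstPoints (2 * side X₀ i) s) (sym eq) (∈-map⁺ (point s) (∈-upTo⁺ j<)))))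
    where
    j< : j < 2 * side X₀ i
    j< = ≤-<-trans (index<side p j) (<-≤-trans
      (proj₁ (proj₁ (box⁻ {side X₀ j} (in-box s j))))
      (subst (λ q → proj₁ q ≤ 2 * side X₀ i) eq (proj₂ (proj₁ (box⁻ {side X₀ i} (Step.in-box i))))))

-- Points of a union of sequences on one line

ι : Point → ℤ × ℤ
ι (x , y) = ℤ.+ x , ℤ.+ y

-- The one property of a line on which the counting rests; it keeps the count apart from the real
-- numbers.
Linear : Pred (ℤ × ℤ) 0ℓ → Set
Linear L = ∀ {p q r} → L (ι p) → L (ι q) → L (ι r) → Aligned p q r

range : ∀ {X₀} → Sequence X₀ → Pred (ℤ × ℤ) 0ℓ
range s v = ∃[ j ] ι (point s j) ≡ v

⋃range : ∀ {X₀} → List (Sequence X₀) → Pred (ℤ × ℤ) 0ℓ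
⋃range ss v = Any (λ s → range s v) ss

record Split (P Q : Pred (ℤ × ℤ) 0ℓ) (vs : List (ℤ × ℤ)) : Set where
  field
    left right : List (ℤ × ℤ)
    leftP      : All P left
    rightQ     : All Q right
    left⊆      : ∀ {v} → v ∈ left → v ∈ vs
    right⊆     : ∀ {v} → v ∈ right → v ∈ vs
    uniqueˡ    : Unique left
    uniqueʳ    : Unique right
    length≡    : length left + length right ≡ length vs

split : ∀ {P Q vs} → Unique vs → All (λ v → P v ⊎ Q v) vs → Split P Q vs
split []         []            = record
  { left = [] ; right = [] ; leftP = [] ; rightQ = [] ; left⊆ = λ () ; right⊆ = λ ()
  ; uniqueˡ = [] ; uniqueʳ = [] ; length≡ = refl }
split (v∉ ∷ u) (pq ∷ pqs) with split u pqs
split (v∉ ∷ u) (inj₁ p ∷ pqs) | s = record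
  { left = _ ∷ left ; right = right ; leftP = p ∷ leftP ; rightQ = rightQ
  ; left⊆ = λ { (here e) → here e ; (there v∈) → there (left⊆ v∈) }
  ; right⊆ = λ v∈ → there (right⊆ v∈)
  ; uniqueˡ = All.tabulate (λ v∈ → All.lookup v∉ (left⊆ v∈)) ∷ uniqueˡ ; uniqueʳ = uniqueʳ
  ; length≡ = cong suc length≡ }
  where open Split s
split (v∉ ∷ u) (inj₂ q ∷ pqs) | s = record
  { left = left ; right = _ ∷ right ; leftP = leftP ; rightQ = q ∷ rightQ
  ; left⊆ = λ v∈ → there (left⊆ v∈)
  ; right⊆ = λ { (here e) → here e ; (there v∈) → there (right⊆ v∈) }
  ; uniqueˡ = uniqueˡ ; uniqueʳ = All.tabulate (λ v∈ → All.lookup v∉ (right⊆ v∈)) ∷ uniqueʳ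
  ; length≡ = trans (+-suc (length left) (length right)) (cong suc length≡) }
  where open Split s

module _ {X₀ : ℕ} {L : Pred (ℤ × ℤ) 0ℓ} (linear : Linear L) where

  sorted-line≤3 : (s : Sequence X₀) (js : List ℕ) → Linked _≤_ js → Unique js →
    All (λ j → L (ι (point s j))) js → length js ≤ 3
  sorted-line≤3 s []                _ _ _ = z≤n
  sorted-line≤3 s (_ ∷ [])          _ _ _ = s≤s z≤n
  sorted-line≤3 s (_ ∷ _ ∷ [])      _ _ _ = s≤s (s≤s z≤n)
  sorted-line≤3 s (_ ∷ _ ∷ _ ∷ [])  _ _ _ = ≤-refl
  sorted-line≤3 s (i ∷ j ∷ k ∷ l ∷ _) (i≤j ∷ j≤k ∷ k≤l ∷ _)
    ((i≢j ∷ _) ∷ (j≢k ∷ _) ∷ (k≢l ∷ _) ∷ _) (pi ∷ pj ∷ pk ∷ pl ∷ _) =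
    ⊥-elim (no-four s (≤∧≢⇒< i≤j i≢j) (≤∧≢⇒< j≤k j≢k) (≤∧≢⇒< k≤l k≢l)
      (linear pi pj pk) (linear pi pj pl))

  indices : (s : Sequence X₀) {vs : List (ℤ × ℤ)} → All (range s) vs →
    ∃[ js ] map (λ j → ι (point s j)) js ≡ vs
  indices s []             = [] , refl
  indices s ((j , eq) ∷ a) = let js , eqs = indices s a in j ∷ js , cong₂ _∷_ eq eqs

  -- `no-four` speaks of increasing indices while the points arrive in any order. The indices are
  -- therefore sorted first; they are distinct because the points are.
  line≤3 : (s : Sequence X₀) {vs : List (ℤ × ℤ)} → Unique vs → All L vs → All (range s) vs →
    length vs ≤ 3
  line≤3 s u onL inS with js , refl ← indices s inS =
    subst (_≤ 3) (trans (↭-length (Sort.sort-↭ js)) (sym (length-map (λ j → ι (point s j)) js)))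
      (sorted-line≤3 s (Sort.sort js) (Sort.sort-↗ js)
        (Unique-resp-↭ (setoid ℕ) (↭⇒↭ₛ (↭-sym (Sort.sort-↭ js))) (map⁻ u))
        (All-resp-↭ (↭-sym (Sort.sort-↭ js)) (AllP.map⁻ onL)))

  line≤ : (ss : List (Sequence X₀)) {vs : List (ℤ × ℤ)} → Unique vs → All L vs →
    All (⋃range ss) vs → length vs ≤ length ss * 3
  line≤ []       {[]}    u onL _       = z≤n
  line≤ []       {_ ∷ _} u onL (() ∷ _)
  line≤ (s ∷ ss) {vs}    u onL inS = subst (_≤ 3 + length ss * 3) length≡
    (+-mono-≤ (line≤3 s uniqueˡ (AllP.anti-mono left⊆ onL) leftP)
              (line≤ ss uniqueʳ (AllP.anti-mono right⊆ onL) rightQ))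
    where
    open Split (split {P = range s} {Q = ⋃range ss} u (All.map Any.toSum inS))

-- Null sequences, and lines of the real plane

ℤ→ℚ : ℤ → ℚ
ℤ→ℚ i = i ℚ./ 1

ℤ→ℚ-toℚᵘ : ∀ i → toℚᵘ (ℤ→ℚ i) ℚᵘ.≃ mkℚᵘ i 0
ℤ→ℚ-toℚᵘ i = ℚP.toℚᵘ-fromℚᵘ (mkℚᵘ i 0)

ℤ→ℚ-injective : ∀ {i j} → ℤ→ℚ i ≡ ℤ→ℚ j → i ≡ j
ℤ→ℚ-injective {i} {j} eq with *≡* e ← ℚP.fromℚᵘ-injective {mkℚᵘ i 0} {mkℚᵘ j 0} eq =
  trans (sym (ℤP.*-identityʳ i)) (trans e (ℤP.*-identityʳ j))

ℤ→ℚ-+ : ∀ i j → ℤ→ℚ (i ℤ.+ j) ≡ ℤ→ℚ i ℚ.+ ℤ→ℚ j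
ℤ→ℚ-+ i j = ℚP.toℚᵘ-injective (begin
  toℚᵘ (ℤ→ℚ (i ℤ.+ j))                  ≈⟨ ℤ→ℚ-toℚᵘ (i ℤ.+ j) ⟩
  mkℚᵘ (i ℤ.+ j) 0
    ≡⟨ cong (λ k → mkℚᵘ k 0) (cong₂ ℤ._+_ (sym (ℤP.*-identityʳ i)) (sym (ℤP.*-identityʳ j))) ⟩
  mkℚᵘ i 0 ℚᵘ.+ mkℚᵘ j 0                ≈⟨ ℚᵘP.+-cong (ℤ→ℚ-toℚᵘ i) (ℤ→ℚ-toℚᵘ j) ⟨
  toℚᵘ (ℤ→ℚ i) ℚᵘ.+ toℚᵘ (ℤ→ℚ j)        ≈⟨ ℚP.toℚᵘ-homo-+ (ℤ→ℚ i) (ℤ→ℚ j) ⟨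
  toℚᵘ (ℤ→ℚ i ℚ.+ ℤ→ℚ j)                ∎)
  where open ℚᵘP.≃-Reasoning

ℤ→ℚ-* : ∀ i j → ℤ→ℚ (i ℤ.* j) ≡ ℤ→ℚ i ℚ.* ℤ→ℚ j
ℤ→ℚ-* i j = ℚP.toℚᵘ-injective (begin
  toℚᵘ (ℤ→ℚ (i ℤ.* j))                  ≈⟨ ℤ→ℚ-toℚᵘ (i ℤ.* j) ⟩
  mkℚᵘ i 0 ℚᵘ.* mkℚᵘ j 0                ≈⟨ ℚᵘP.*-cong (ℤ→ℚ-toℚᵘ i) (ℤ→ℚ-toℚᵘ j) ⟨
  toℚᵘ (ℤ→ℚ i) ℚᵘ.* toℚᵘ (ℤ→ℚ j)        ≈⟨ ℚP.toℚᵘ-homo-* (ℤ→ℚ i) (ℤ→ℚ j) ⟨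
  toℚᵘ (ℤ→ℚ i ℚ.* ℤ→ℚ j)                ∎)
  where open ℚᵘP.≃-Reasoning

ℤ→ℚ-- : ∀ i j → ℤ→ℚ (i ℤ.- j) ≡ ℤ→ℚ i ℚ.- ℤ→ℚ j
ℤ→ℚ-- i j = begin
  ℤ→ℚ (i ℤ.- j)                            ≡⟨ add-sub (ℤ→ℚ (i ℤ.- j)) (ℤ→ℚ j) ⟩
  ℤ→ℚ (i ℤ.- j) ℚ.+ ℤ→ℚ j ℚ.- ℤ→ℚ j        ≡⟨ cong (ℚ._- ℤ→ℚ j) (ℤ→ℚ-+ (i ℤ.- j) j) ⟨
  ℤ→ℚ (i ℤ.- j ℤ.+ j) ℚ.- ℤ→ℚ j            ≡⟨ cong (λ k → ℤ→ℚ k ℚ.- ℤ→ℚ j) (cancel i j) ⟩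
  ℤ→ℚ i ℚ.- ℤ→ℚ j                          ∎
  where
  open ≡-Reasoning
  cancel : ∀ i j → i ℤ.- j ℤ.+ j ≡ i
  cancel = solve-∀ℤ
  add-sub : ∀ p q → p ≡ p ℚ.+ q ℚ.- q
  add-sub = solve 2 (λ p q → p := p :+ q :- q) refl
    where open ℚSolver.+-*-Solver

ℤ→ℚ-mono : ∀ {a b} → a ≤ b → ℤ→ℚ (ℤ.+ a) ℚ.≤ ℤ→ℚ (ℤ.+ b)
ℤ→ℚ-mono {a} {b} a≤b = ℚP.toℚᵘ-cancel-≤
  (ℚᵘP.≤-respˡ-≃ (ℚᵘP.≃-sym (ℤ→ℚ-toℚᵘ (ℤ.+ a))) (ℚᵘP.≤-respʳ-≃ (ℚᵘP.≃-sym (ℤ→ℚ-toℚᵘ (ℤ.+ b)))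
    (ℚᵘ.*≤* (subst₂ ℤ._≤_ (sym (ℤP.*-identityʳ (ℤ.+ a))) (sym (ℤP.*-identityʳ (ℤ.+ b))) (ℤ.+≤+ a≤b)))))

-- Phrased so that `points l (embed v)` unfolds to nullity of the sequence α x + β y - γ at `v`.
Null : (ℕ → ℚ) → Set
Null f = ∀ ε → 0ℚ ℚ.< ε → Eventually λ n → ℚ.∣ f n ∣ ℚ.< ε

null-cong : ∀ {f g} → (∀ n → f n ≡ g n) → Null f → Null g
null-cong f≡g nf ε 0<ε = let N , h = nf ε 0<ε in
  N , λ n N≤n → subst (λ q → ℚ.∣ q ∣ ℚ.< ε) (f≡g n) (h n N≤n)

null-+ : ∀ {f g} → Null f → Null g → Null (λ n → f n ℚ.+ g n)
null-+ {f} {g} nf ng ε 0<ε =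
  let M , hf = nf (½ ℚ.* ε) half>0
      N , hg = ng (½ ℚ.* ε) half>0
  in M ⊔ N , λ n p → begin-strict
    ℚ.∣ f n ℚ.+ g n ∣              ≤⟨ ℚP.∣p+q∣≤∣p∣+∣q∣ (f n) (g n) ⟩
    ℚ.∣ f n ∣ ℚ.+ ℚ.∣ g n ∣
      <⟨ ℚP.+-mono-< (hf n (m⊔n≤o⇒m≤o M N p)) (hg n (m⊔n≤o⇒n≤o M N p)) ⟩
    ½ ℚ.* ε ℚ.+ ½ ℚ.* ε          ≡⟨ ℚP.*-distribʳ-+ ε ½ ½ ⟨
    1ℚ ℚ.* ε                     ≡⟨ ℚP.*-identityˡ ε ⟩
    ε                            ∎
  where
  open ℚP.≤-Reasoning
  half>0 : 0ℚ ℚ.< ½ ℚ.* ε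
  half>0 = ℚP.positive⁻¹ _ {{ℚP.pos*pos⇒pos ½ ε {{ℚ.positive 0<ε}}}}

null-*ˡ : ∀ c {f} → Null f → Null (λ n → c ℚ.* f n)
null-*ˡ c {f} nf ε 0<ε = let N , h = nf (ℚ.1/ d ℚ.* ε) δ>0 in
  N , λ n N≤n → begin-strict
    ℚ.∣ c ℚ.* f n ∣            ≡⟨ ℚP.∣p*q∣≡∣p∣*∣q∣ c (f n) ⟩
    ℚ.∣ c ∣ ℚ.* ℚ.∣ f n ∣        ≤⟨ ℚP.*-monoʳ-≤-nonNeg ℚ.∣ f n ∣ {{ℚP.∣-∣-nonNeg (f n)}} c≤d ⟩
    d ℚ.* ℚ.∣ f n ∣            <⟨ ℚP.*-monoʳ-<-pos d (h n N≤n) ⟩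
    d ℚ.* (ℚ.1/ d ℚ.* ε)     ≡⟨ ℚP.*-assoc d (ℚ.1/ d) ε ⟨
    d ℚ.* ℚ.1/ d ℚ.* ε       ≡⟨ cong (ℚ._* ε) (ℚP.*-inverseʳ d) ⟩
    1ℚ ℚ.* ε                 ≡⟨ ℚP.*-identityˡ ε ⟩
    ε                        ∎
  where
  open ℚP.≤-Reasoning
  -- The summand 1 keeps the divisor positive when `c` is 0.
  d : ℚ
  d = 1ℚ ℚ.+ ℚ.∣ c ∣
  instance
    d>0 : ℚ.Positive d
    d>0 = ℚP.pos+nonNeg⇒pos 1ℚ ℚ.∣ c ∣ {{ℚP.∣-∣-nonNeg c}}
    d≢0 : ℚ.NonZero d
    d≢0 = ℚP.pos⇒nonZero d
  δ>0 : 0ℚ ℚ.< ℚ.1/ d ℚ.* ε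
  δ>0 = ℚP.positive⁻¹ _ {{ℚP.pos*pos⇒pos (ℚ.1/ d) {{ℚP.1/pos⇒pos d}} ε {{ℚ.positive 0<ε}}}}
  c≤d : ℚ.∣ c ∣ ℚ.≤ d
  c≤d = subst (ℚ._≤ d) (ℚP.+-identityˡ ℚ.∣ c ∣) (ℚP.+-monoˡ-≤ ℚ.∣ c ∣ (ℚP.<⇒≤ (ℚP.positive⁻¹ 1ℚ)))

null-cancelˡ : ∀ c .{{_ : ℚ.NonZero c}} {f} → Null (λ n → c ℚ.* f n) → Null f
null-cancelˡ c {f} ncf = null-cong cancel (null-*ˡ (ℚ.1/ c) ncf)
  where
  cancel : ∀ n → ℚ.1/ c ℚ.* (c ℚ.* f n) ≡ f n
  cancel n = trans (sym (ℚP.*-assoc (ℚ.1/ c) c (f n)))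
    (trans (cong (ℚ._* f n) (ℚP.*-inverseˡ c)) (ℚP.*-identityˡ (f n)))

-- With E the equation α x + β y − γ evaluated at a point, Cramer's rule
-- expresses D · α and D · β, D the determinant of q − p and r − p, through the
-- three null sequences E p, E q, E r.
line-linear : ∀ l → Linear (λ v → points l (embed v))
line-linear l {p₁ , p₂} {q₁ , q₂} {r₁ , r₂} onp onq onr with aligned? (p₁ , p₂) (q₁ , q₂) (r₁ , r₂)
... | yes c = c
... | no ¬c = ⊥-elim (nondegenerate (≃0 {α} α-null , ≃0 {β} β-null))
  where
  open Line l
  x y z u v w D : ℚ
  x = ℤ→ℚ (ℤ.+ p₁) ; y = ℤ→ℚ (ℤ.+ q₁) ; z = ℤ→ℚ (ℤ.+ r₁)
  u = ℤ→ℚ (ℤ.+ p₂) ; v = ℤ→ℚ (ℤ.+ q₂) ; w = ℤ→ℚ (ℤ.+ r₂)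
  D = (y ℚ.- x) ℚ.* (w ℚ.- u) ℚ.- (v ℚ.- u) ℚ.* (z ℚ.- x)

  hom : ∀ a b c d → ℤ→ℚ ((a ℤ.- b) ℤ.* (c ℤ.- d)) ≡ (ℤ→ℚ a ℚ.- ℤ→ℚ b) ℚ.* (ℤ→ℚ c ℚ.- ℤ→ℚ d)
  hom a b c d = trans (ℤ→ℚ-* (a ℤ.- b) (c ℤ.- d)) (cong₂ ℚ._*_ (ℤ→ℚ-- a b) (ℤ→ℚ-- c d))

  D≢0 : D ≢ 0ℚ
  D≢0 D≡0 = ¬c (ℤ→ℚ-injective (begin
    ℤ→ℚ ((ℤ.+ q₁ ℤ.- ℤ.+ p₁) ℤ.* (ℤ.+ r₂ ℤ.- ℤ.+ p₂))   ≡⟨ hom (ℤ.+ q₁) (ℤ.+ p₁) (ℤ.+ r₂) (ℤ.+ p₂) ⟩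
    (y ℚ.- x) ℚ.* (w ℚ.- u)                             ≡⟨ sub-add _ _ ⟩
    D ℚ.+ (v ℚ.- u) ℚ.* (z ℚ.- x)                       ≡⟨ cong (ℚ._+ (v ℚ.- u) ℚ.* (z ℚ.- x)) D≡0 ⟩
    0ℚ ℚ.+ (v ℚ.- u) ℚ.* (z ℚ.- x)                      ≡⟨ ℚP.+-identityˡ _ ⟩
    (v ℚ.- u) ℚ.* (z ℚ.- x)                             ≡⟨ hom (ℤ.+ q₂) (ℤ.+ p₂) (ℤ.+ r₁) (ℤ.+ p₁) ⟨
    ℤ→ℚ ((ℤ.+ q₂ ℤ.- ℤ.+ p₂) ℤ.* (ℤ.+ r₁ ℤ.- ℤ.+ p₁))   ∎))
    where
    open ≡-Reasoning
    sub-add : ∀ a b → a ≡ a ℚ.- b ℚ.+ b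
    sub-add = solve 2 (λ a b → a := a :- b :+ b) refl
      where open ℚSolver.+-*-Solver

  instance
    D-nonZero : ℚ.NonZero D
    D-nonZero = ℚ.≢-nonZero D≢0

  combination : ∀ a b c {f} →
    (∀ n → a ℚ.* (seq α n ℚ.* x ℚ.+ seq β n ℚ.* u ℚ.- seq γ n) ℚ.+
           b ℚ.* (seq α n ℚ.* y ℚ.+ seq β n ℚ.* v ℚ.- seq γ n) ℚ.+
           c ℚ.* (seq α n ℚ.* z ℚ.+ seq β n ℚ.* w ℚ.- seq γ n) ≡ D ℚ.* f n) → Null f
  combination a b c eq = null-cancelˡ D (null-cong eq
    (null-+ (null-+ (null-*ˡ a onp) (null-*ˡ b onq)) (null-*ˡ c onr)))

  α-null : Null (seq α)
  α-null = combination (v ℚ.- w) (w ℚ.- u) (u ℚ.- v) λ n →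
    solve 9 (λ x y z u v w α β γ →
      (v :- w) :* (α :* x :+ β :* u :- γ) :+ (w :- u) :* (α :* y :+ β :* v :- γ) :+
      (u :- v) :* (α :* z :+ β :* w :- γ) :=
      ((y :- x) :* (w :- u) :- (v :- u) :* (z :- x)) :* α)
      refl x y z u v w (seq α n) (seq β n) (seq γ n)
    where open ℚSolver.+-*-Solver

  β-null : Null (seq β)
  β-null = combination (z ℚ.- y) (x ℚ.- z) (y ℚ.- x) λ n →
    solve 9 (λ x y z u v w α β γ →
      (z :- y) :* (α :* x :+ β :* u :- γ) :+ (x :- z) :* (α :* y :+ β :* v :- γ) :+
      (y :- x) :* (α :* z :+ β :* w :- γ) :=
      ((y :- x) :* (w :- u) :- (v :- u) :* (z :- x)) :* β)
      refl x y z u v w (seq α n) (seq β n) (seq γ n)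
    where open ℚSolver.+-*-Solver

  ≃0 : ∀ {a} → Null (seq a) → a ≃ 0ᴿ
  ≃0 {a} = null-cong λ n → sym (ℚP.+-identityʳ (seq a n))

no-collinear : ∀ {X₀} k (ss : List (Sequence X₀)) → length ss * 3 ≤ k →
  No (suc k) Collinear (⋃range ss)
no-collinear k ss 3t≤k l p p-inj p∈S p∈l = <⇒≱ (s≤s 3t≤k)
  (subst (_≤ length ss * 3) (length-tabulate p)
    (line≤ {L = λ v → points l (embed v)} (λ {p} {q} {r} → line-linear l {p} {q} {r}) ss
      (tabulate⁺ p-inj) (AllP.tabulate⁺ {f = p} p∈l) (AllP.tabulate⁺ {f = p} p∈S)))

-- Counting the points in the grid

grid? : ∀ n v → Dec (grid n v)
grid? n (i , j) = ((ℤ.+ 1 ℤP.≤? i) ×-dec (i ℤP.≤? ℤ.+ n)) ×-dec ((ℤ.+ 1 ℤP.≤? j) ×-dec (j ℤP.≤? ℤ.+ n))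

ι-injective : ∀ {p q} → ι p ≡ ι q → p ≡ q
ι-injective refl = refl

module _ {X₀ : ℕ} (ss : List (Sequence X₀)) (disjoint : AllPairs Disjoint ss) where

  initial : ℕ → List (ℤ × ℤ)
  initial n = concatMap (λ s → map ι (firstPoints n s)) ss

  ∈-initial⁺ : ∀ {n s j} → s ∈ ss → j < n → ι (point s j) ∈ initial n
  ∈-initial⁺ {n} {s} s∈ j<n = ∈-concatMap⁺ (λ s → map ι (firstPoints n s))
    (lose s∈ (∈-map⁺ ι (∈-map⁺ (point s) (∈-upTo⁺ j<n))))

  ∈-initial⁻ : ∀ {n v} → v ∈ initial n → ∃[ s ] (s ∈ ss × ∃[ j ] (j < n × v ≡ ι (point s j)))
  ∈-initial⁻ {n} v∈
    with s , s∈ , v∈s ← find (∈-concatMap⁻ (λ s → map ι (firstPoints n s)) {xs = ss} v∈)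
    with p , p∈ , refl ← ∈-map⁻ ι v∈s
    with j , j∈ , refl ← ∈-map⁻ (point s) p∈
    = s , s∈ , j , ∈-upTo⁻ j∈ , refl

  initial-unique : ∀ n → Unique (initial n)
  initial-unique n = concat⁺
    (AllP.map⁺ (All.tabulate λ {s} _ → map⁺ ι-injective (map⁺ (point-injective s) (upTo⁺ n))))
    (AllPairsP.map⁺ (AllPairs.map (λ {s} {s′} → apart {s} {s′}) disjoint))
    where
    point-injective : ∀ s {i j} → point s i ≡ point s j → i ≡ j
    point-injective s {i} {j} eq with <-cmp i j
    ... | tri< i<j _ _ = ⊥-elim (distinct s i<j eq)
    ... | tri≈ _ i≡j _ = i≡j
    ... | tri> _ _ j<i = ⊥-elim (distinct s j<i (sym eq))
    apart : ∀ {s s′} → Disjoint s s′ → ∀ {v} →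
      ¬ (v ∈ map ι (firstPoints n s) × v ∈ map ι (firstPoints n s′))
    apart {s} {s′} d (v∈ , v∈′)
      with p , p∈ , refl ← ∈-map⁻ ι v∈
      with q , q∈ , eq ← ∈-map⁻ ι v∈′
      with i , _ , refl ← ∈-map⁻ (point s) p∈
      with j , _ , refl ← ∈-map⁻ (point s′) q∈
      = d i j (ι-injective eq)

  length-initial : ∀ n → length (initial n) ≡ length ss * n
  length-initial n = length-concatMap _ ss n λ s →
    trans (length-map ι (firstPoints n s)) (length-firstPoints n s)

  inGrid : ℕ → List (ℤ × ℤ)
  inGrid n = filter (grid? n) (initial n)

  -- Completeness of the list: the j-th point has first coordinate above `side X₀ j`, hence above j,
  -- so a point of the n-grid has index below n and occurs in `initial n`.
  inGrid-cardinality : 2000 ≤ X₀ → ∀ n →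
    HasCardinality (⋃range ss ∩ grid n) (length (inGrid n))
  inGrid-cardinality 2000≤X₀ n =
    inGrid n , filter⁺ (grid? n) (initial-unique n) , (λ v → mk⇔ (to v) (from v)) , refl
    where
    to : ∀ v → v ∈ inGrid n → ⋃range ss v × grid n v
    to v v∈ with v∈′ , g ← ∈-filter⁻ (grid? n) {xs = initial n} v∈
            with s , s∈ , j , _ , refl ← ∈-initial⁻ {n} v∈′
            = lose s∈ (j , refl) , g
    from : ∀ v → ⋃range ss v × grid n v → v ∈ inGrid n
    from v (v∈ , g) with s , s∈ , j , refl ← find v∈ =
      ∈-filter⁺ (grid? n) (∈-initial⁺ s∈ j<n) g
      where
      j<n : j < n
      j<n = ≤-<-trans (index<side 2000≤X₀ j) (<-≤-trans
        (proj₁ (proj₁ (box⁻ {side X₀ j} (in-box s j)))) (ℤP.drop‿+≤+ (proj₂ (proj₁ g))))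

  -- Points of index below `J` have coordinates at most twice their side, hence at most
  -- `2 * X₀ + 8000 * J`; so all of `initial J` lies in the grid.
  inGrid-≥ : 2000 ≤ X₀ → ∀ n J → 2 * X₀ + 8000 * J ≤ n → length ss * J ≤ length (inGrid n)
  inGrid-≥ 2000≤X₀ n J room = subst (_≤ length (inGrid n)) (length-initial J)
    (length-injection (inGrid n) (λ v → v) (initial-unique J) (λ _ _ eq → eq) into)
    where
    into : ∀ {v} → v ∈ initial J → v ∈ inGrid n
    into v∈ with s , s∈ , j , j<J , refl ← ∈-initial⁻ {J} v∈ =
      let (X<x , x≤) , (X<y , y≤) = box⁻ {side X₀ j} (in-box s j)
      in ∈-filter⁺ (grid? n) (∈-initial⁺ s∈ j<n)
           ((ℤ.+≤+ (≤-trans (s≤s z≤n) X<x) , ℤ.+≤+ (≤-trans x≤ 2side≤n)) ,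
            (ℤ.+≤+ (≤-trans (s≤s z≤n) X<y) , ℤ.+≤+ (≤-trans y≤ 2side≤n)))
      where
      open ≤-Reasoning
      2side≤n : 2 * side X₀ j ≤ n
      2side≤n = begin
        2 * side X₀ j             ≤⟨ *-monoʳ-≤ 2 (side-≤ X₀ j) ⟩
        2 * (X₀ + 4000 * j)       ≡⟨ *-distribˡ-+ 2 X₀ (4000 * j) ⟩
        2 * X₀ + 2 * (4000 * j)   ≡⟨ cong (2 * X₀ +_) (*-assoc 2 4000 j) ⟨
        2 * X₀ + 8000 * j         ≤⟨ +-monoʳ-≤ (2 * X₀) (*-monoʳ-≤ 8000 (<⇒≤ j<J)) ⟩
        2 * X₀ + 8000 * J         ≤⟨ room ⟩
        n                         ∎
      j<n : j < n
      j<n = begin-strict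
        j                   ≤⟨ m≤n*m j 8000 ⟩
        8000 * j            <⟨ *-monoʳ-< 8000 j<J ⟩
        8000 * J            ≤⟨ m≤n+m (8000 * J) (2 * X₀) ⟩
        2 * X₀ + 8000 * J   ≤⟨ room ⟩
        n                   ∎

-- The density constant and the theorem

quotient-≥ : ∀ n d .{{_ : NonZero d}} → d ≤ n → n ≤ 2 * d * (n / d)
quotient-≥ n d d≤n = begin
  n                              ≡⟨ m≡m%n+[m/n]*n n d ⟩
  n % d + n / d * d              ≤⟨ +-monoˡ-≤ (n / d * d) (<⇒≤ (m%n<n n d)) ⟩
  d + n / d * d                  ≤⟨ +-monoˡ-≤ (n / d * d) (m≤n*m d (n / d) {{>-nonZero (m≥n⇒m/n>0 d≤n)}}) ⟩
  n / d * d + n / d * d          ≡⟨ eq (n / d) d ⟩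
  2 * d * (n / d)                ∎
  where
  open ≤-Reasoning
  eq : ∀ q d → q * d + q * d ≡ 2 * d * q
  eq = solve-∀

unitFraction : (d : ℕ) → .{{NonZero d}} → ℚ
unitFraction d = ℤ.+ 1 ℚ./ d

unitFraction-positive : ∀ d .{{_ : NonZero d}} → ℚ.Positive (unitFraction d)
unitFraction-positive d = ℚP.normalize-pos 1 d

unitFraction-inverse : ∀ d .{{_ : NonZero d}} → unitFraction d ℚ.* ℤ→ℚ (ℤ.+ d) ≡ 1ℚ
unitFraction-inverse d@(suc e) = ℚP.toℚᵘ-injective (begin
  toℚᵘ (unitFraction d ℚ.* ℤ→ℚ (ℤ.+ d))            ≈⟨ ℚP.toℚᵘ-homo-* (unitFraction d) (ℤ→ℚ (ℤ.+ d)) ⟩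
  toℚᵘ (unitFraction d) ℚᵘ.* toℚᵘ (ℤ→ℚ (ℤ.+ d))
    ≈⟨ ℚᵘP.*-cong (ℚP.toℚᵘ-fromℚᵘ (mkℚᵘ (ℤ.+ 1) e)) (ℤ→ℚ-toℚᵘ (ℤ.+ d)) ⟩
  mkℚᵘ (ℤ.+ 1) e ℚᵘ.* mkℚᵘ (ℤ.+ d) 0
    ≈⟨ *≡* (trans (ℤP.*-identityʳ (ℤ.+ 1 ℤ.* ℤ.+ d))
                  (cong (λ k → ℤ.+ 1 ℤ.* ℤ.+ k) (sym (*-identityʳ d)))) ⟩
  ℚᵘ.1ℚᵘ                                           ∎)
  where open ℚᵘP.≃-Reasoning

unitFraction-≤ : ∀ d .{{_ : NonZero d}} k n m → k * n ≤ d * m →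
  unitFraction d ℚ.* ℤ→ℚ (ℤ.+ k) ℚ.* ℤ→ℚ (ℤ.+ n) ℚ.≤ ℤ→ℚ (ℤ.+ m)
unitFraction-≤ d k n m kn≤dm = begin
  u ℚ.* ℤ→ℚ (ℤ.+ k) ℚ.* ℤ→ℚ (ℤ.+ n)        ≡⟨ ℚP.*-assoc u (ℤ→ℚ (ℤ.+ k)) (ℤ→ℚ (ℤ.+ n)) ⟩
  u ℚ.* (ℤ→ℚ (ℤ.+ k) ℚ.* ℤ→ℚ (ℤ.+ n))      ≡⟨ cong (u ℚ.*_) (product k n) ⟨
  u ℚ.* ℤ→ℚ (ℤ.+ (k * n))
    ≤⟨ ℚP.*-monoˡ-≤-nonNeg u {{ℚP.pos⇒nonNeg u {{unitFraction-positive d}}}} (ℤ→ℚ-mono kn≤dm) ⟩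
  u ℚ.* ℤ→ℚ (ℤ.+ (d * m))                  ≡⟨ cong (u ℚ.*_) (product d m) ⟩
  u ℚ.* (ℤ→ℚ (ℤ.+ d) ℚ.* ℤ→ℚ (ℤ.+ m))      ≡⟨ ℚP.*-assoc u (ℤ→ℚ (ℤ.+ d)) (ℤ→ℚ (ℤ.+ m)) ⟨
  u ℚ.* ℤ→ℚ (ℤ.+ d) ℚ.* ℤ→ℚ (ℤ.+ m)        ≡⟨ cong (ℚ._* ℤ→ℚ (ℤ.+ m)) (unitFraction-inverse d) ⟩
  1ℚ ℚ.* ℤ→ℚ (ℤ.+ m)                       ≡⟨ ℚP.*-identityˡ (ℤ→ℚ (ℤ.+ m)) ⟩
  ℤ→ℚ (ℤ.+ m)                              ∎
  where
  open ℚP.≤-Reasoning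
  u : ℚ
  u = unitFraction d
  product : ∀ a b → ℤ→ℚ (ℤ.+ (a * b)) ≡ ℤ→ℚ (ℤ.+ a) ℚ.* ℤ→ℚ (ℤ.+ b)
  product a b = trans (cong ℤ→ℚ (ℤP.pos-* a b)) (ℤ→ℚ-* (ℤ.+ a) (ℤ.+ b))

density-bound : ∀ d .{{_ : NonZero d}} k n m → k * n ≤ d * m →
  fromℚ (unitFraction d) *ᴿ fromℕ k *ᴿ fromℕ n ≤ᴿ fromℕ m
density-bound d k n m kn≤dm ε 0<ε = 0 , λ _ _ → ℚP.≤-trans (unitFraction-≤ d k n m kn≤dm)
  (subst (ℚ._≤ ℤ→ℚ (ℤ.+ m) ℚ.+ ε) (ℚP.+-identityʳ _) (ℚP.+-monoʳ-≤ (ℤ→ℚ (ℤ.+ m)) (ℚP.<⇒≤ 0<ε)))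

density-positive : ∀ d .{{_ : NonZero d}} → 0ᴿ <ᴿ fromℚ (unitFraction d)
density-positive d = unitFraction d , ℚP.positive⁻¹ _ {{unitFraction-positive d}} ,
  0 , λ _ _ → ℚP.≤-reflexive (ℚP.+-identityˡ (unitFraction d))

mainTheorem2 : ∃[ c′ ] (0ᴿ <ᴿ c′ ×
    (∀ (k : ℕ) → 3 ≤ k →
    Σ[ S ∈ Pred (ℤ × ℤ) 0ℓ ] Σ[ nₖ ∈ ℕ ]
    (No (suc k) Collinear S ×
    (∀ (n : ℕ) → nₖ ≤ n →
    ∃[ m ] (HasCardinality (S ∩ grid n) m ×
    c′ *ᴿ fromℕ k *ᴿ fromℕ n ≤ᴿ fromℕ m)))))
mainTheorem2 = fromℚ (unitFraction 192000) , density-positive 192000 , λ k 3≤k →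
  -- A line meets each sequence in at most 3 points, so `k / 3` sequences keep it within k. `X₀` is
  -- chosen to exceed both 2000 and `8 * t`.
  let t = k / 3
      X₀ = 2000 + 8 * t
      2000≤X₀ = m≤m+n 2000 (8 * t)
      ss , len , disjoint = disjointSequences {X₀} t 2000≤X₀ (m≤n+m (8 * t) 2000)
  -- The count takes J = `n / 16000`. Half of n pays for `8000 * J`, the other half for `2 * X₀`,
  -- whence `4 * X₀`; the 16000 makes J at least 1.
  in ⋃range ss , 4 * X₀ + 16000 ,
     no-collinear k ss (subst (λ t → t * 3 ≤ k) (sym len) (m/n*n≤m k 3)) ,
     λ n nₖ≤n →
       let m = length (inGrid ss disjoint n) in
       m , inGrid-cardinality ss disjoint 2000≤X₀ n ,
       density-bound 192000 k n m (enough k n m X₀ 3≤k nₖ≤n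
         (subst (λ t → t * (n / 16000) ≤ m) len
           (inGrid-≥ ss disjoint 2000≤X₀ n (n / 16000) (room n X₀ nₖ≤n))))
  where
  open ≤-Reasoning
  room : ∀ n X₀ → 4 * X₀ + 16000 ≤ n → 2 * X₀ + 8000 * (n / 16000) ≤ n
  room n X₀ p = *-cancelˡ-≤ 2 (begin
    2 * (2 * X₀ + 8000 * (n / 16000))     ≡⟨ eq X₀ (n / 16000) ⟩
    4 * X₀ + n / 16000 * 16000
      ≤⟨ +-mono-≤ (≤-trans (m≤m+n (4 * X₀) 16000) p) (m/n*n≤m n 16000) ⟩
    n + n                                 ≡⟨ cong (n +_) (sym (+-identityʳ n)) ⟩
    2 * n                                 ∎)
    where
    eq : ∀ X q → 2 * (2 * X + 8000 * q) ≡ 4 * X + q * 16000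
    eq = solve-∀
  -- Each rounding down costs at most a factor 2: k ≤ 6 ⌊k/3⌋ and n ≤ 32000 ⌊n/16000⌋. The product 6
  -- · 32000 = 192000 is the denominator of the constant.
  enough : ∀ k n m X₀ → 3 ≤ k → 4 * X₀ + 16000 ≤ n → k / 3 * (n / 16000) ≤ m → k * n ≤ 192000 * m
  enough k n m X₀ 3≤k p q = begin
    k * n
      ≤⟨ *-mono-≤ (quotient-≥ k 3 3≤k) (quotient-≥ n 16000 (≤-trans (m≤n+m 16000 (4 * X₀)) p)) ⟩
    6 * (k / 3) * (32000 * (n / 16000))          ≡⟨ eq (k / 3) (n / 16000) ⟩
    192000 * (k / 3 * (n / 16000))               ≤⟨ *-monoʳ-≤ 192000 q ⟩
    192000 * m                                   ∎
    where
    eq : ∀ a b → 6 * a * (32000 * b) ≡ 192000 * (a * b)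
    eq = solve-∀
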